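{- For every odd positive integer $n$, $$\sigma_{7}(n)=12\left(864\sum_{\substack{i,j,k,l\ge 0\\ i+j+k+l=n}}\widehat{\sigma}(i)\,\widehat{\sigma}(j)\,\widehat{\sigma}(k)\,\widehat{\sigma}(l)-\sum_{\substack{i,j\ge 0\\ i+j=n}}\widehat{\sigma}(i)\,\widetilde{\sigma}_{5}(j)\right),$$ where $\widehat{\sigma}(0)=\tfrac1{24}$ and $\widetilde{\sigma}_{5}(0)=\tfrac18$.
   Context: For integers $n\ge1$, $\sigma_{s}(n)=\sum_{d\mid n}d^{s}$, $\widetilde{\sigma}_{s}(n)=\sum_{d\mid n}(-1)^{d-1}d^{s}$ and $\widehat{\sigma}(n)=\widehat{\sigma}_{1}(n)=\sum_{d\mid n}(-1)^{n/d-1}d$. Values at $0$ are assigned as in the claim. -}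

module Defs where

open import Data.Bool using (if_then_else_)
open import Data.Integer as ℤ using (ℤ; +_; 0ℤ; -1ℤ)
open import Data.List using (List; cartesianProduct; filter; foldr; map; upTo)
open import Data.Nat as ℕ using (ℕ; zero; suc; NonZero; _∸_)
open import Data.Nat.Divisibility using (_∣?_)
open import Data.Nat.DivMod using (_/_)
open import Data.Product using (_×_; _,_)
open import Data.Rational as ℚ using (ℚ; 0ℚ)
open import Relation.Nullary using (does)

fromℤ : ℤ → ℚ
fromℤ z = z ℚ./ 1

-- For n ≥ 1 every divisor d of n is suc k for a unique k < n.  For n = 0 the
-- range is empty, so the sum is 0; this junk value is replaced by _at0_ below.
∑-divisors : (n : ℕ) → ((d : ℕ) → .{{NonZero d}} → ℤ) → ℤ
∑-divisors n f =
  foldr ℤ._+_ 0ℤ (map (λ k → if does (suc k ∣? n) then f (suc k) else 0ℤ) (upTo n))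

σ : ℕ → ℕ → ℤ
σ s n = ∑-divisors n (λ d → (+ d) ℤ.^ s)

σ̃ : ℕ → ℕ → ℤ
σ̃ s n = ∑-divisors n (λ d → (-1ℤ ℤ.^ (d ∸ 1)) ℤ.* ((+ d) ℤ.^ s))

σ̂ : ℕ → ℤ
σ̂ n = ∑-divisors n (λ d → (-1ℤ ℤ.^ (n / d ∸ 1)) ℤ.* (+ d))

-- f on the positive integers, with the value c assigned at 0.
_at0_ : (ℕ → ℤ) → ℚ → ℕ → ℚ
(f at0 c) zero    = c
(f at0 c) (suc n) = fromℤ (f (suc n))

∑ : {A : Set} → List A → (A → ℚ) → ℚ
∑ xs f = foldr ℚ._+_ 0ℚ (map f xs)

-- In a decomposition of n into natural numbers each summand is at most n, so
-- restricting the search to 0, …, n loses nothing.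
pairs : ℕ → List (ℕ × ℕ)
pairs n = filter (λ (i , j) → i ℕ.+ j ℕ.≟ n) (cartesianProduct r r)
  where r = upTo (suc n)

quadruples : ℕ → List (ℕ × ℕ × ℕ × ℕ)
quadruples n =
  filter (λ (i , j , k , l) → i ℕ.+ j ℕ.+ k ℕ.+ l ℕ.≟ n)
         (cartesianProduct r (cartesianProduct r (cartesianProduct r r)))
  where r = upTo (suc n)

{-# OPTIONS --safe #-}
-- Let ĥ and t̃ be the generating functions of σ̂ and σ̃₅ with constant terms 1/24 and 1/8.
-- The substitution (a , b , x , y) ↦ (a - b , b , x , x + y) is a bijection from the
-- solutions of ax + by = n in positive integers with a > b to those with x < y.  Hence, if
-- F and P are invariant under (a , b , x , y) ↦ (b , a , y , x) and
--   F(a + b , b , x , y) = F(a , b , x , x + y) + P(a , b , x , x + y),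
-- the sum of P over all solutions reduces to the boundary terms with x = y or a = b, which
-- are divisor sums.  For P = 576 (-1)^(x+y) ab this shows that 12 ĥ² has a divisor sum as
-- its coefficients, and so 72 (12 ĥ²)² - 12 ĥ t̃ is again, up to divisor sums, a sum over
-- ax + by = n of a polynomial P of degree 6 in a and b whose coefficients depend on the
-- parities of x and y.  A suitable F exists, and the coefficient of qⁿ in
-- 12 (864 ĥ⁴ - ĥ t̃) is the sum of (-7 - 8 (-1)^m) d⁷ over dm = n, for every n ≥ 1.
module Submission where

open import Defs
open import Data.Bool using (if_then_else_; true; false)
open import Data.Fin.Patterns using (0F; 1F; 2F; 3F; 4F)
open import Data.Integer as ℤ using (ℤ; +_; 0ℤ; 1ℤ; -1ℤ)
import Data.Integer.Properties as ℤₚ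
import Data.Integer.Solver as ℤ-Solver
open import Data.List using (List; []; _∷_; _++_; cartesianProduct; filter; foldr; map; upTo)
open import Data.List.Properties using (map-upTo)
open import Data.Nat as ℕ using (ℕ; zero; suc; _≤_; _<_; z≤n; s≤s; NonZero; _∸_)
open import Data.Nat.Divisibility using (_∣_; _∤_; _∣?_; divides; ∣-trans; m∣m*n; n∣m*n)
open import Data.Nat.DivMod using (m*n/n≡m)
import Data.Nat.Properties as ℕₚ
import Data.Nat.Solver as ℕ-Solver
open import Data.Product using (_×_; _,_)
open import Data.Rational as ℚ using (ℚ)
import Data.Rational.Properties as ℚₚ
import Data.Rational.Solver as ℚ-Solver
import Data.Rational.Unnormalised as ℚᵘ
import Data.Rational.Unnormalised.Properties as ℚᵘₚ
open import Data.Sum using ([_,_]′)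
open import Data.Vec as Vec using (Vec; []; _∷_; lookup)
open import Data.Vec.Properties using (lookup-map)
open import Function using (_∘_)
open import Relation.Binary.PropositionalEquality
  using (_≡_; _≢_; refl; sym; trans; cong; cong₂; subst; module ≡-Reasoning)
open import Relation.Nullary using (Dec; does; yes; no; ¬_; contradiction)
open import Relation.Nullary.Decidable using (toSum)
open import Relation.Unary using (Pred; Decidable)

-- Positive variables are coded as successors: with B = `suc b`, C = `suc c`, X = `suc x`, Y =
-- `suc y` this is (B + C) X + B Y = C X + B (X + Y).
ℕ-shear : ∀ b c x y → suc (suc (b ℕ.+ c)) ℕ.* suc x ℕ.+ suc b ℕ.* suc y ≡
                      suc c ℕ.* suc x ℕ.+ suc b ℕ.* suc (suc (x ℕ.+ y))
ℕ-shear = solve 4 (λ b c x y →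
  (con 2 :+ (b :+ c)) :* (con 1 :+ x) :+ (con 1 :+ b) :* (con 1 :+ y) :=
  (con 1 :+ c) :* (con 1 :+ x) :+ (con 1 :+ b) :* (con 2 :+ (x :+ y))) refl
  where open ℕ-Solver.+-*-Solver

module _ where
  open import Algebra.Properties.AbelianGroup ℤₚ.+-0-abelianGroup using (∙-cancelˡ; ∙-cancelʳ)
  open import Data.Integer using (_+_; _*_; _-_; -_; _^_)
  open import Data.Nat.DivMod using (_/_)
  open ℤ-Solver using (module +-*-Solver)
  open +-*-Solver
    using (Polynomial; op; con; var; _:+_; _:*_; _:^_; _:-_; :-_; ⟦_⟧; ⟦_⟧N; sem; normalise; prove; solve; _:=_)
  open ≡-Reasoning

  private variable
    A B : Set

  -- Finite sums

  ∑ᶻ : List A → (A → ℤ) → ℤ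
  ∑ᶻ []       f = 0ℤ
  ∑ᶻ (x ∷ xs) f = f x + ∑ᶻ xs f

  +-congˡ : ∀ c {a b} → a ≡ b → c + a ≡ c + b
  +-congˡ c = cong (λ s → c + s)

  ∑< : ℕ → (ℕ → ℤ) → ℤ
  ∑< n = ∑ᶻ (upTo n)

  ∑ᶻ-cong : ∀ (xs : List A) {f g : A → ℤ} → (∀ x → f x ≡ g x) → ∑ᶻ xs f ≡ ∑ᶻ xs g
  ∑ᶻ-cong []       eq = refl
  ∑ᶻ-cong (x ∷ xs) eq = cong₂ _+_ (eq x) (∑ᶻ-cong xs eq)

  ∑ᶻ-0 : ∀ (xs : List A) {f : A → ℤ} → (∀ x → f x ≡ 0ℤ) → ∑ᶻ xs f ≡ 0ℤ
  ∑ᶻ-0 []       eq = refl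
  ∑ᶻ-0 (x ∷ xs) eq = cong₂ _+_ (eq x) (∑ᶻ-0 xs eq)

  +-interchange : ∀ a b c d → (a + b) + (c + d) ≡ (a + c) + (b + d)
  +-interchange = solve 4 (λ a b c d → (a :+ b) :+ (c :+ d) := (a :+ c) :+ (b :+ d)) refl

  ∑ᶻ-+ : ∀ (xs : List A) (f g : A → ℤ) → ∑ᶻ xs (λ x → f x + g x) ≡ ∑ᶻ xs f + ∑ᶻ xs g
  ∑ᶻ-+ []       f g = refl
  ∑ᶻ-+ (x ∷ xs) f g = trans (+-congˡ (f x + g x) (∑ᶻ-+ xs f g)) (+-interchange (f x) (g x) (∑ᶻ xs f) (∑ᶻ xs g))

  ∑ᶻ-*ˡ : ∀ (xs : List A) c (f : A → ℤ) → ∑ᶻ xs (λ x → c * f x) ≡ c * ∑ᶻ xs f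
  ∑ᶻ-*ˡ []       c f = sym (ℤₚ.*-zeroʳ c)
  ∑ᶻ-*ˡ (x ∷ xs) c f = trans (+-congˡ (c * f x) (∑ᶻ-*ˡ xs c f)) (sym (ℤₚ.*-distribˡ-+ c (f x) (∑ᶻ xs f)))

  ∑ᶻ-*ʳ : ∀ (xs : List A) c (f : A → ℤ) → ∑ᶻ xs (λ x → f x * c) ≡ ∑ᶻ xs f * c
  ∑ᶻ-*ʳ []       c f = sym (ℤₚ.*-zeroˡ c)
  ∑ᶻ-*ʳ (x ∷ xs) c f = trans (+-congˡ (f x * c) (∑ᶻ-*ʳ xs c f)) (sym (ℤₚ.*-distribʳ-+ c (f x) (∑ᶻ xs f)))

  ∑ᶻ-comm : ∀ (xs : List A) (ys : List B) (f : A → B → ℤ) →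
            ∑ᶻ xs (λ x → ∑ᶻ ys (λ y → f x y)) ≡ ∑ᶻ ys (λ y → ∑ᶻ xs (λ x → f x y))
  ∑ᶻ-comm []       ys f = sym (∑ᶻ-0 ys λ _ → refl)
  ∑ᶻ-comm (x ∷ xs) ys f =
    trans (+-congˡ (∑ᶻ ys (f x)) (∑ᶻ-comm xs ys f)) (sym (∑ᶻ-+ ys (f x) λ y → ∑ᶻ xs λ x → f x y))

  ∑ᶻ-++ : ∀ (xs ys : List A) (f : A → ℤ) → ∑ᶻ (xs ++ ys) f ≡ ∑ᶻ xs f + ∑ᶻ ys f
  ∑ᶻ-++ []       ys f = sym (ℤₚ.+-identityˡ _)
  ∑ᶻ-++ (x ∷ xs) ys f = trans (+-congˡ (f x) (∑ᶻ-++ xs ys f)) (sym (ℤₚ.+-assoc (f x) (∑ᶻ xs f) (∑ᶻ ys f)))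

  ∑ᶻ-map : ∀ (h : A → B) (xs : List A) (f : B → ℤ) → ∑ᶻ (map h xs) f ≡ ∑ᶻ xs (f ∘ h)
  ∑ᶻ-map h []       f = refl
  ∑ᶻ-map h (x ∷ xs) f = +-congˡ (f (h x)) (∑ᶻ-map h xs f)

  ∑ᶻ-cartesianProduct : ∀ (xs : List A) (ys : List B) (f : A × B → ℤ) →
                        ∑ᶻ (cartesianProduct xs ys) f ≡ ∑ᶻ xs (λ x → ∑ᶻ ys (λ y → f (x , y)))
  ∑ᶻ-cartesianProduct []       ys f = refl
  ∑ᶻ-cartesianProduct (x ∷ xs) ys f =
    trans (∑ᶻ-++ (map (x ,_) ys) _ f)
          (cong₂ _+_ (∑ᶻ-map (x ,_) ys f) (∑ᶻ-cartesianProduct xs ys f))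

  ⟦_⟧? : {P : Set} → Dec P → ℤ
  ⟦ P? ⟧? = if does P? then 1ℤ else 0ℤ

  ∑ᶻ-foldr : ∀ {A : Set} (xs : List A) f → foldr _+_ 0ℤ (map f xs) ≡ ∑ᶻ xs f
  ∑ᶻ-foldr []       f = refl
  ∑ᶻ-foldr (x ∷ xs) f = +-congˡ (f x) (∑ᶻ-foldr xs f)

  ∑ᶻ-filter : ∀ {P : Pred A _} (P? : Decidable P) (xs : List A) (f : A → ℤ) →
              ∑ᶻ (filter P? xs) f ≡ ∑ᶻ xs (λ x → ⟦ P? x ⟧? * f x)
  ∑ᶻ-filter P? []       f = refl
  ∑ᶻ-filter P? (x ∷ xs) f with does (P? x)
  ... | true  = cong₂ _+_ (sym (ℤₚ.*-identityˡ (f x))) (∑ᶻ-filter P? xs f)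
  ... | false = trans (∑ᶻ-filter P? xs f)
                      (sym (trans (cong (λ z → z + ∑ᶻ xs (λ x → ⟦ P? x ⟧? * f x)) (ℤₚ.*-zeroˡ (f x))) (ℤₚ.+-identityˡ _)))

  ∑<-suc : ∀ n f → ∑< (suc n) f ≡ f 0 + ∑< n (f ∘ suc)
  ∑<-suc n f = +-congˡ (f 0)
    (trans (cong (λ xs → ∑ᶻ xs f) (sym (map-upTo suc n))) (∑ᶻ-map suc (upTo n) f))

  -- Truncated sums stand for sums over all of ℕ: under this condition every bound from `N` on gives
  -- the same value.
  VanishesFrom : ℕ → (ℕ → ℤ) → Set
  VanishesFrom N f = ∀ k → N ≤ k → f k ≡ 0ℤ

  ∑<-cong : ∀ n {f g} → (∀ k → k < n → f k ≡ g k) → ∑< n f ≡ ∑< n g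
  ∑<-cong zero    eq = refl
  ∑<-cong (suc n) {f} {g} eq = begin
    ∑< (suc n) f           ≡⟨ ∑<-suc n f ⟩
    f 0 + ∑< n (f ∘ suc)   ≡⟨ cong₂ _+_ (eq 0 (s≤s z≤n)) (∑<-cong n λ k k<n → eq (suc k) (s≤s k<n)) ⟩
    g 0 + ∑< n (g ∘ suc)   ≡⟨ sym (∑<-suc n g) ⟩
    ∑< (suc n) g           ∎

  ∑<-extend : ∀ {m n} f → m ≤ n → VanishesFrom m f → ∑< n f ≡ ∑< m f
  ∑<-extend {n = n} f z≤n vf = ∑ᶻ-0 (upTo n) λ k → vf k z≤n
  ∑<-extend {suc m} {suc n} f (s≤s m≤n) vf = begin
    ∑< (suc n) f           ≡⟨ ∑<-suc n f ⟩
    f 0 + ∑< n (f ∘ suc)   ≡⟨ +-congˡ (f 0) (∑<-extend (f ∘ suc) m≤n λ k m≤k → vf (suc k) (s≤s m≤k)) ⟩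
    f 0 + ∑< m (f ∘ suc)   ≡⟨ sym (∑<-suc m f) ⟩
    ∑< (suc m) f           ∎

  -- The Kronecker delta

  δ : ℕ → ℕ → ℤ
  δ m n = ⟦ m ℕ.≟ n ⟧?

  δ-refl : ∀ n → δ n n ≡ 1ℤ
  δ-refl zero    = refl
  δ-refl (suc n) = δ-refl n

  δ-≢ : ∀ m n → m ≢ n → δ m n ≡ 0ℤ
  δ-≢ zero    zero    m≢n = contradiction refl m≢n
  δ-≢ zero    (suc n) m≢n = refl
  δ-≢ (suc m) zero    m≢n = refl
  δ-≢ (suc m) (suc n) m≢n = δ-≢ m n (m≢n ∘ cong suc)

  δ-> : ∀ m n → n < m → δ m n ≡ 0ℤ
  δ-> m n n<m = δ-≢ m n λ { refl → ℕₚ.<-irrefl refl n<m }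

  -- A summand weighted by `δ m n` matters only where the equation holds, so that equation may be
  -- used to rewrite it.
  δ-*-cong : ∀ m n {x y} → (m ≡ n → x ≡ y) → δ m n * x ≡ δ m n * y
  δ-*-cong m n {x} {y} eq =
    [ (λ m≡n → cong (δ m n *_) (eq m≡n))
    , (λ m≢n → trans (δ*≡0 m≢n x) (sym (δ*≡0 m≢n y))) ]′ (toSum (m ℕ.≟ n))
    where
    δ*≡0 : m ≢ n → ∀ z → δ m n * z ≡ 0ℤ
    δ*≡0 m≢n z = trans (cong (_* z) (δ-≢ m n m≢n)) (ℤₚ.*-zeroˡ z)

  -- For `m` outside the range the sum is zero, and the vanishing of `f` from `N` on makes `f m`
  -- zero as well.
  ∑<-δ : ∀ N m f → VanishesFrom N f → ∑< N (λ k → δ m k * f k) ≡ f m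
  ∑<-δ zero    m f vf = sym (vf m z≤n)
  ∑<-δ (suc N) zero f vf = begin
    ∑< (suc N) (λ k → δ 0 k * f k)          ≡⟨ ∑<-suc N (λ k → δ 0 k * f k) ⟩
    1ℤ * f 0 + ∑< N (λ k → 0ℤ * f (suc k))  ≡⟨ cong₂ _+_ (ℤₚ.*-identityˡ (f 0)) (∑ᶻ-0 (upTo N) λ k → ℤₚ.*-zeroˡ (f (suc k))) ⟩
    f 0 + 0ℤ                                ≡⟨ ℤₚ.+-identityʳ (f 0) ⟩
    f 0                                     ∎
  ∑<-δ (suc N) (suc m) f vf = begin
    ∑< (suc N) (λ k → δ (suc m) k * f k)          ≡⟨ ∑<-suc N (λ k → δ (suc m) k * f k) ⟩
    0ℤ * f 0 + ∑< N (λ k → δ m k * f (suc k))     ≡⟨ cong₂ _+_ (ℤₚ.*-zeroˡ (f 0)) (∑<-δ N m (f ∘ suc) λ k N≤k → vf (suc k) (s≤s N≤k)) ⟩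
    0ℤ + f (suc m)                                ≡⟨ ℤₚ.+-identityˡ _ ⟩
    f (suc m)                                     ∎

  ∑<-δʳ : ∀ {N n} (f : ℕ → ℤ) → n < N → ∑< N (λ k → δ k n * f k) ≡ f n
  ∑<-δʳ {suc N} {zero} f n<N = begin
    ∑< (suc N) (λ k → δ k 0 * f k)          ≡⟨ ∑<-suc N (λ k → δ k 0 * f k) ⟩
    1ℤ * f 0 + ∑< N (λ k → 0ℤ * f (suc k))  ≡⟨ cong₂ _+_ (ℤₚ.*-identityˡ (f 0)) (∑ᶻ-0 (upTo N) λ k → ℤₚ.*-zeroˡ (f (suc k))) ⟩
    f 0 + 0ℤ                                ≡⟨ ℤₚ.+-identityʳ (f 0) ⟩
    f 0                                     ∎
  ∑<-δʳ {suc N} {suc n} f (s≤s n<N) = begin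
    ∑< (suc N) (λ k → δ k (suc n) * f k)       ≡⟨ ∑<-suc N (λ k → δ k (suc n) * f k) ⟩
    0ℤ * f 0 + ∑< N (λ k → δ k n * f (suc k))  ≡⟨ cong₂ _+_ (ℤₚ.*-zeroˡ (f 0)) (∑<-δʳ (f ∘ suc) n<N) ⟩
    0ℤ + f (suc n)                             ≡⟨ ℤₚ.+-identityˡ (f (suc n)) ⟩
    f (suc n)                                  ∎

  δ-⇔ : ∀ m n m′ n′ → (m ≡ n → m′ ≡ n′) → (m′ ≡ n′ → m ≡ n) → δ m n ≡ δ m′ n′
  δ-⇔ m n m′ n′ to from =
    [ (λ m≡n → trans (δ-≡ m≡n) (sym (δ-≡ (to m≡n))))
    , (λ m≢n → trans (δ-≢ m n m≢n) (sym (δ-≢ m′ n′ (m≢n ∘ from)))) ]′ (toSum (m ℕ.≟ n))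
    where
    δ-≡ : ∀ {m n} → m ≡ n → δ m n ≡ 1ℤ
    δ-≡ {m} refl = δ-refl m

  -- Convolutions and sums over the solutions of ax + by = n

  ∑∑ : ℕ → (ℕ → ℕ → ℤ) → ℤ
  ∑∑ N f = ∑< N λ k → ∑< N λ l → f k l

  ∑∑-cong : ∀ N {f g} → (∀ k l → f k l ≡ g k l) → ∑∑ N f ≡ ∑∑ N g
  ∑∑-cong N eq = ∑ᶻ-cong (upTo N) λ k → ∑ᶻ-cong (upTo N) (eq k)

  ∑∑-comm : ∀ N f → ∑∑ N f ≡ ∑∑ N (λ k l → f l k)
  ∑∑-comm N f = ∑ᶻ-comm (upTo N) (upTo N) f

  ∑∑-+ : ∀ N f g → ∑∑ N (λ k l → f k l + g k l) ≡ ∑∑ N f + ∑∑ N g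
  ∑∑-+ N f g = trans (∑ᶻ-cong (upTo N) λ k → ∑ᶻ-+ (upTo N) (f k) (g k))
                     (∑ᶻ-+ (upTo N) (λ k → ∑< N (f k)) (λ k → ∑< N (g k)))

  ∑∑-*ˡ : ∀ N c f → ∑∑ N (λ k l → c * f k l) ≡ c * ∑∑ N f
  ∑∑-*ˡ N c f = trans (∑ᶻ-cong (upTo N) λ k → ∑ᶻ-*ˡ (upTo N) c (f k))
                      (∑ᶻ-*ˡ (upTo N) c (λ k → ∑< N (f k)))

  ∑∑-*ʳ : ∀ N c f → ∑∑ N (λ k l → f k l * c) ≡ ∑∑ N f * c
  ∑∑-*ʳ N c f = trans (∑ᶻ-cong (upTo N) λ k → ∑ᶻ-*ʳ (upTo N) c (f k))
                      (∑ᶻ-*ʳ (upTo N) c (λ k → ∑< N (f k)))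

  ∑-∑∑-comm : ∀ N (f : ℕ → ℕ → ℕ → ℤ) →
              ∑< N (λ i → ∑∑ N (f i)) ≡ ∑∑ N (λ k l → ∑< N (λ i → f i k l))
  ∑-∑∑-comm N f = trans (∑ᶻ-comm (upTo N) (upTo N) λ i k → ∑< N (f i k))
                        (∑ᶻ-cong (upTo N) λ k → ∑ᶻ-comm (upTo N) (upTo N) λ i l → f i k l)

  ∑∑-fubini : ∀ N (f : ℕ → ℕ → ℕ → ℕ → ℤ) →
              ∑∑ N (λ a b → ∑∑ N (f a b)) ≡ ∑∑ N (λ x y → ∑∑ N (λ a b → f a b x y))
  ∑∑-fubini N f = trans (∑ᶻ-cong (upTo N) λ a → ∑-∑∑-comm N (f a))
                        (∑-∑∑-comm N λ a x y → ∑< N λ b → f a b x y)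

  -- The coefficient of q^i in the sum of f(k , l) q^m(k , l). Addition as `m` gives convolutions,
  -- multiplication gives divisor sums.
  Push : ℕ → (ℕ → ℕ → ℕ) → (ℕ → ℕ → ℤ) → ℕ → ℤ
  Push N m f i = ∑∑ N λ k l → δ (m k l) i * f k l

  Push-sift : ∀ N m f {W} → VanishesFrom N W →
              ∑< N (λ i → Push N m f i * W i) ≡ ∑∑ N (λ k l → f k l * W (m k l))
  Push-sift N m f {W} vW = begin
    ∑< N (λ i → Push N m f i * W i)
      ≡⟨ ∑ᶻ-cong (upTo N) (λ i → trans (sym (∑∑-*ʳ N (W i) λ k l → δ (m k l) i * f k l))
                                       (∑∑-cong N λ k l → rearrange (δ (m k l) i) (f k l) (W i))) ⟩
    ∑< N (λ i → ∑∑ N λ k l → f k l * (δ (m k l) i * W i))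
      ≡⟨ ∑-∑∑-comm N (λ i k l → f k l * (δ (m k l) i * W i)) ⟩
    ∑∑ N (λ k l → ∑< N λ i → f k l * (δ (m k l) i * W i))
      ≡⟨ ∑∑-cong N (λ k l → trans (∑ᶻ-*ˡ (upTo N) (f k l) λ i → δ (m k l) i * W i)
                                  (cong (f k l *_) (∑<-δ N (m k l) W vW))) ⟩
    ∑∑ N (λ k l → f k l * W (m k l))  ∎
    where
    rearrange : ∀ a b c → (a * b) * c ≡ b * (a * c)
    rearrange = solve 3 (λ a b c → (a :* b) :* c := b :* (a :* c)) refl

  conv : ℕ → (ℕ → ℤ) → (ℕ → ℤ) → ℕ → ℤ
  conv N u v = Push N ℕ._+_ λ i j → u i * v j

  -- `Push-sift` is applied once for each factor; `n < N` makes the δ weights vanish at indices from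
  -- `N` on.
  conv-Push : ∀ N m f g {n} → n < N →
              conv N (Push N m f) (Push N m g) n ≡
              ∑∑ N (λ a x → ∑∑ N (λ b y → δ (m a x ℕ.+ m b y) n * (f a x * g b y)))
  conv-Push N m f g {n} n<N = begin
    conv N (Push N m f) (Push N m g) n
      ≡⟨ ∑ᶻ-cong (upTo N) (λ i → trans
           (∑ᶻ-cong (upTo N) λ j → rearrange (δ (i ℕ.+ j) n) (Push N m f i) (Push N m g j))
           (∑ᶻ-*ˡ (upTo N) (Push N m f i) λ j → Push N m g j * δ (i ℕ.+ j) n)) ⟩
    ∑< N (λ i → Push N m f i * W i)
      ≡⟨ Push-sift N m f vW ⟩
    ∑∑ N (λ a x → f a x * W (m a x))
      ≡⟨ ∑∑-cong N (λ a x → trans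
           (cong (f a x *_) (Push-sift N m g (vδ (m a x))))
           (trans (sym (∑∑-*ˡ N (f a x) λ b y → g b y * δ (m a x ℕ.+ m b y) n))
                  (∑∑-cong N λ b y → sym (rearrange (δ (m a x ℕ.+ m b y) n) (f a x) (g b y))))) ⟩
    ∑∑ N (λ a x → ∑∑ N (λ b y → δ (m a x ℕ.+ m b y) n * (f a x * g b y)))  ∎
    where
    rearrange : ∀ a b c → a * (b * c) ≡ b * (c * a)
    rearrange = solve 3 (λ a b c → a :* (b :* c) := b :* (c :* a)) refl
    W : ℕ → ℤ
    W i = ∑< N λ j → Push N m g j * δ (i ℕ.+ j) n
    vδ : ∀ i → VanishesFrom N λ j → δ (i ℕ.+ j) n
    vδ i j N≤j = δ-> (i ℕ.+ j) n (ℕₚ.<-≤-trans n<N (ℕₚ.≤-trans N≤j (ℕₚ.m≤n+m j i)))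
    vW : VanishesFrom N W
    vW i N≤i = ∑ᶻ-0 (upTo N) λ j → trans
      (cong (Push N m g j *_) (δ-> (i ℕ.+ j) n (ℕₚ.<-≤-trans n<N (ℕₚ.≤-trans N≤i (ℕₚ.m≤m+n i j)))))
      (ℤₚ.*-zeroʳ (Push N m g j))

  -- For n < N the bound N is harmless: D N f n is the sum of f d m over dm = n and
  -- S N n F that of F a b x y over ax + by = n, all variables being positive.
  D : ℕ → (ℕ → ℕ → ℤ) → ℕ → ℤ
  D N f = Push N (λ k l → suc k ℕ.* suc l) λ k l → f (suc k) (suc l)

  S : ℕ → ℕ → (ℕ → ℕ → ℕ → ℕ → ℤ) → ℤ
  S N n F = ∑∑ N λ a b → ∑∑ N λ x y →
    δ (suc a ℕ.* suc x ℕ.+ suc b ℕ.* suc y) n * F (suc a) (suc b) (suc x) (suc y)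

  conv-D : ∀ N f g {n} → n < N → conv N (D N f) (D N g) n ≡ S N n (λ a b x y → f a x * g b y)
  conv-D N f g {n} n<N =
    trans (conv-Push N (λ k l → suc k ℕ.* suc l) (λ k l → f (suc k) (suc l)) (λ k l → g (suc k) (suc l)) n<N)
          (∑ᶻ-cong (upTo N) λ a → ∑ᶻ-comm (upTo N) (upTo N) λ x b → ∑< N λ y →
             δ (suc a ℕ.* suc x ℕ.+ suc b ℕ.* suc y) n * (f (suc a) (suc x) * g (suc b) (suc y)))

  S-cong : ∀ N n {F G} → (∀ a b x y → F a b x y ≡ G a b x y) → S N n F ≡ S N n G
  S-cong N n eq = ∑∑-cong N λ a b → ∑∑-cong N λ x y →
    cong (δ (suc a ℕ.* suc x ℕ.+ suc b ℕ.* suc y) n *_) (eq (suc a) (suc b) (suc x) (suc y))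

  S-+ : ∀ N n F G → S N n (λ a b x y → F a b x y + G a b x y) ≡ S N n F + S N n G
  S-+ N n F G = trans
    (∑∑-cong N λ a b → trans
      (∑∑-cong N λ x y → ℤₚ.*-distribˡ-+ (δ (suc a ℕ.* suc x ℕ.+ suc b ℕ.* suc y) n)
        (F (suc a) (suc b) (suc x) (suc y)) (G (suc a) (suc b) (suc x) (suc y)))
      (∑∑-+ N _ _))
    (∑∑-+ N (λ a b → ∑∑ N λ x y → δ (suc a ℕ.* suc x ℕ.+ suc b ℕ.* suc y) n * F (suc a) (suc b) (suc x) (suc y))
            (λ a b → ∑∑ N λ x y → δ (suc a ℕ.* suc x ℕ.+ suc b ℕ.* suc y) n * G (suc a) (suc b) (suc x) (suc y)))

  -- Euclidean telescoping

  -- The pairs with a > b are parametrised by b and c = a - b - 1. Letting both run below `N` also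
  -- reaches some a ≥ N, where the terms vanish. The induction peels off the row and the column of
  -- index 0.
  ∑∑-split : ∀ N (g : ℕ → ℕ → ℤ) → (∀ a b → g a b ≡ g b a) → (∀ a b → N ≤ a → g a b ≡ 0ℤ) →
             ∑∑ N g ≡ + 2 * ∑∑ N (λ b c → g (suc (b ℕ.+ c)) b) + ∑< N (λ b → g b b)
  ∑∑-split zero    g g-sym vg = refl
  ∑∑-split (suc N) g g-sym vg = begin
    ∑∑ (suc N) g
      ≡⟨ ∑<-suc N (λ a → ∑< (suc N) (g a)) ⟩
    ∑< (suc N) (g 0) + ∑< N (λ a → ∑< (suc N) (g (suc a)))
      ≡⟨ cong₂ _+_ (∑<-suc N (g 0)) (trans
           (∑ᶻ-cong (upTo N) λ a → ∑<-suc N (g (suc a)))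
           (∑ᶻ-+ (upTo N) (λ a → g (suc a) 0) (λ a → ∑< N λ b → g′ a b))) ⟩
    (g 0 0 + ∑< N (λ b → g 0 (suc b))) + (∑< N (λ a → g (suc a) 0) + ∑∑ N g′)
      ≡⟨ cong₂ (λ u v → (g 0 0 + u) + (E + v)) (∑ᶻ-cong (upTo N) λ b → g-sym 0 (suc b))
           (∑∑-split N g′ (λ a b → g-sym (suc a) (suc b)) (λ a b N≤a → vg (suc a) (suc b) (s≤s N≤a))) ⟩
    (g 0 0 + E) + (E + (+ 2 * T′ + Δ′))
      ≡⟨ rearrange (g 0 0) E T′ Δ′ ⟩
    + 2 * (E + T′) + (g 0 0 + Δ′)
      ≡⟨ cong₂ (λ u v → + 2 * u + v) (sym T-suc) (sym (∑<-suc N λ b → g b b)) ⟩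
    + 2 * ∑∑ (suc N) (λ b c → g (suc (b ℕ.+ c)) b) + ∑< (suc N) (λ b → g b b)  ∎
    where
    rearrange : ∀ a e t d → (a + e) + (e + (+ 2 * t + d)) ≡ + 2 * (e + t) + (a + d)
    rearrange = solve 4 (λ a e t d → (a :+ e) :+ (e :+ (con (+ 2) :* t :+ d)) := con (+ 2) :* (e :+ t) :+ (a :+ d)) refl
    g′ : ℕ → ℕ → ℤ
    g′ a b = g (suc a) (suc b)
    E T′ Δ′ : ℤ
    E  = ∑< N λ a → g (suc a) 0
    T′ = ∑∑ N λ b c → g′ (suc (b ℕ.+ c)) b
    Δ′ = ∑< N λ b → g′ b b
    T-suc : ∑∑ (suc N) (λ b c → g (suc (b ℕ.+ c)) b) ≡ E + T′
    T-suc = trans (∑<-suc N λ b → ∑< (suc N) λ c → g (suc (b ℕ.+ c)) b)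
      (cong₂ _+_ (∑<-extend (λ c → g (suc c) 0) (ℕₚ.n≤1+n N) λ c N≤c → vg (suc c) 0 (s≤s N≤c))
                 (∑ᶻ-cong (upTo N) λ b → ∑<-extend (λ c → g′ (suc (b ℕ.+ c)) b) (ℕₚ.n≤1+n N) λ c N≤c →
                    vg (suc (suc (b ℕ.+ c))) (suc b) (s≤s (ℕₚ.m≤n⇒m≤1+n (ℕₚ.≤-trans N≤c (ℕₚ.m≤n+m c b))))))

  -- Sums over the decompositions d = a + b with a, b ≥ 1.
  comp : ℕ → (ℕ → ℕ → ℤ) → ℤ
  comp zero          φ = 0ℤ
  comp (suc zero)    φ = 0ℤ
  comp (suc (suc d)) φ = φ 1 (suc d) + comp (suc d) (λ a b → φ (suc a) b)

  comp-cong : ∀ d {φ ψ} → (∀ a b → φ a b ≡ ψ a b) → comp d φ ≡ comp d ψ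
  comp-cong zero          eq = refl
  comp-cong (suc zero)    eq = refl
  comp-cong (suc (suc d)) eq = cong₂ _+_ (eq 1 (suc d)) (comp-cong (suc d) λ a b → eq (suc a) b)

  -- Groups the pairs by their sum; in the applications `K` is the δ of an equation in a + b. The
  -- induction strips off the pairs with a = 1.
  ∑∑-comp : ∀ N K φ → VanishesFrom N K →
            ∑∑ N (λ a b → K (suc a ℕ.+ suc b) * φ (suc a) (suc b)) ≡ ∑< N (λ d → K (suc d) * comp (suc d) φ)
  ∑∑-comp zero    K φ vK = refl
  ∑∑-comp (suc N) K φ vK = begin
    ∑∑ (suc N) (λ a b → K (suc a ℕ.+ suc b) * φ (suc a) (suc b))
      ≡⟨ ∑<-suc N (λ a → ∑< (suc N) λ b → K (suc a ℕ.+ suc b) * φ (suc a) (suc b)) ⟩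
    ∑< (suc N) (λ b → K (suc (suc b)) * φ 1 (suc b)) + ∑< N (λ a → ∑< (suc N) λ b → K′ (suc a ℕ.+ suc b) * φ′ (suc a) (suc b))
      ≡⟨ cong₂ _+_
           (∑<-extend (λ b → K (suc (suc b)) * φ 1 (suc b)) (ℕₚ.n≤1+n N) (λ b N≤b →
              vanish (suc (suc b)) (φ 1 (suc b)) (s≤s (ℕₚ.m≤n⇒m≤1+n N≤b))))
           (trans (∑ᶻ-cong (upTo N) λ a → ∑<-extend (λ b → K′ (suc a ℕ.+ suc b) * φ′ (suc a) (suc b)) (ℕₚ.n≤1+n N) λ b N≤b →
                     vanish (suc (suc (a ℕ.+ suc b))) (φ′ (suc a) (suc b))
                       (s≤s (ℕₚ.m≤n⇒m≤1+n (ℕₚ.≤-trans N≤b (ℕₚ.≤-trans (ℕₚ.n≤1+n b) (ℕₚ.m≤n+m (suc b) a))))))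
                  (∑∑-comp N K′ φ′ λ k N≤k → vK (suc k) (s≤s N≤k))) ⟩
    ∑< N (λ d → K′ (suc d) * φ 1 (suc d)) + ∑< N (λ d → K′ (suc d) * comp (suc d) φ′)
      ≡⟨ sym (∑ᶻ-+ (upTo N) (λ d → K′ (suc d) * φ 1 (suc d)) (λ d → K′ (suc d) * comp (suc d) φ′)) ⟩
    ∑< N (λ d → K′ (suc d) * φ 1 (suc d) + K′ (suc d) * comp (suc d) φ′)
      ≡⟨ ∑ᶻ-cong (upTo N) (λ d → sym (ℤₚ.*-distribˡ-+ (K′ (suc d)) (φ 1 (suc d)) (comp (suc d) φ′))) ⟩
    ∑< N (λ d → K (suc (suc d)) * comp (suc (suc d)) φ)
      ≡⟨ sym (ℤₚ.+-identityˡ _) ⟩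
    0ℤ + ∑< N (λ d → K (suc (suc d)) * comp (suc (suc d)) φ)
      -- The term d = 1 is restored as a zero, since 1 has no decomposition into two positive parts.
      ≡⟨ cong (λ z → z + ∑< N (λ d → K (suc (suc d)) * comp (suc (suc d)) φ)) (sym (ℤₚ.*-zeroʳ (K 1))) ⟩
    K 1 * comp 1 φ + ∑< N (λ d → K (suc (suc d)) * comp (suc (suc d)) φ)
      ≡⟨ sym (∑<-suc N λ d → K (suc d) * comp (suc d) φ) ⟩
    ∑< (suc N) (λ d → K (suc d) * comp (suc d) φ)  ∎
    where
    K′ : ℕ → ℤ
    K′ k = K (suc k)
    φ′ : ℕ → ℕ → ℤ
    φ′ a b = φ (suc a) b
    vanish : ∀ k x → suc N ≤ k → K k * x ≡ 0ℤ
    vanish k x N<k = trans (cong (_* x) (vK k N<k)) (ℤₚ.*-zeroˡ x)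

  -- The differences of `R` run along the antidiagonal from (0 , k) to (k , 0), so only the two end
  -- values survive.
  comp-telescope : ∀ k {φ} (R : ℕ → ℕ → ℤ) → (∀ a b → φ (suc a) (suc b) ≡ R a (suc b) - R (suc a) b) →
                   comp (suc k) φ ≡ R 0 k - R k 0
  comp-telescope zero    R eq = sym (ℤₚ.+-inverseʳ (R 0 0))
  comp-telescope (suc k) {φ} R eq = begin
    φ 1 (suc k) + comp (suc k) (λ a b → φ (suc a) b)
      ≡⟨ cong₂ _+_ (eq 0 k) (comp-telescope k (λ a b → R (suc a) b) λ a b → eq (suc a) b) ⟩
    (R 0 (suc k) - R 1 k) + (R 1 k - R (suc k) 0)
      ≡⟨ cancel (R 0 (suc k)) (R 1 k) (R (suc k) 0) ⟩
    R 0 (suc k) - R (suc k) 0 ∎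
    where
    cancel : ∀ a b c → (a - b) + (b - c) ≡ a - c
    cancel = solve 3 (λ a b c → (a :- b) :+ (b :- c) := a :- c) refl

  D-cong : ∀ N n f g → (∀ k l → suc k ℕ.* suc l ≡ n → f (suc k) (suc l) ≡ g (suc k) (suc l)) →
           D N f n ≡ D N g n
  D-cong N n f g eq = ∑∑-cong N λ k l → δ-*-cong (suc k ℕ.* suc l) n (eq k l)

  D-+ : ∀ N n f g → D N (λ d m → f d m + g d m) n ≡ D N f n + D N g n
  D-+ N n f g = trans
    (∑∑-cong N λ k l → ℤₚ.*-distribˡ-+ (δ (suc k ℕ.* suc l) n) (f (suc k) (suc l)) (g (suc k) (suc l)))
    (∑∑-+ N (λ k l → δ (suc k ℕ.* suc l) n * f (suc k) (suc l))
            (λ k l → δ (suc k ℕ.* suc l) n * g (suc k) (suc l)))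

  D-*ˡ : ∀ N n c f → D N (λ d m → c * f d m) n ≡ c * D N f n
  D-*ˡ N n c f = trans
    (∑∑-cong N λ k l → rearrange (δ (suc k ℕ.* suc l) n) c (f (suc k) (suc l)))
    (∑∑-*ˡ N c (λ k l → δ (suc k ℕ.* suc l) n * f (suc k) (suc l)))
    where
    rearrange : ∀ a b c → a * (b * c) ≡ b * (a * c)
    rearrange = solve 3 (λ a b c → a :* (b :* c) := b :* (a :* c)) refl

  module Telescoping
    (N n : ℕ) (n<N : n < N) (F G : ℕ → ℕ → ℕ → ℕ → ℤ)
    (F-sym : ∀ a b x y → F a b x y ≡ F b a y x)
    (G-sym : ∀ a b x y → G a b x y ≡ G b a y x)
    (F-shear : ∀ a b x y → F (a ℕ.+ b) b x y ≡ G a b x (x ℕ.+ y))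
    where

    weight : (ℕ → ℕ → ℕ → ℕ → ℤ) → ℕ → ℕ → ℕ → ℕ → ℤ
    weight H a b x y = δ (suc a ℕ.* suc x ℕ.+ suc b ℕ.* suc y) n * H (suc a) (suc b) (suc x) (suc y)

    weight-sym : ∀ H → (∀ a b x y → H a b x y ≡ H b a y x) → ∀ a b x y → weight H a b x y ≡ weight H b a y x
    weight-sym H H-sym a b x y = cong₂ (λ s h → δ s n * h)
      (ℕₚ.+-comm (suc a ℕ.* suc x) (suc b ℕ.* suc y)) (H-sym (suc a) (suc b) (suc x) (suc y))

    δ-vanish : ∀ {s t} → N ≤ s → s ≤ t → δ t n ≡ 0ℤ
    δ-vanish {t = t} N≤s s≤t = δ-> t n (ℕₚ.<-≤-trans n<N (ℕₚ.≤-trans N≤s s≤t))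

    weight-vanish : ∀ H a b x y {s} → N ≤ s → s ≤ suc a ℕ.* suc x ℕ.+ suc b ℕ.* suc y → weight H a b x y ≡ 0ℤ
    weight-vanish H a b x y N≤s s≤ =
      trans (cong (_* H (suc a) (suc b) (suc x) (suc y)) (δ-vanish N≤s s≤)) (ℤₚ.*-zeroˡ (H (suc a) (suc b) (suc x) (suc y)))

    -- The part a > b of the sum of `F`; the shear identifies it with the part x < y of the sum of
    -- `G`.
    T : ℤ
    T = ∑∑ N λ b c → ∑∑ N λ x y → weight F (suc (b ℕ.+ c)) b x y

    -- Both sides solve the same equation, since (b + c) x + b y = c x + b (x + y).
    weight-shear : ∀ b c x y → weight F (suc (b ℕ.+ c)) b x y ≡ weight G c b x (suc (x ℕ.+ y))
    weight-shear b c x y = cong₂ (λ s h → δ s n * h) (ℕ-shear b c x y) (begin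
      F (suc (suc (b ℕ.+ c))) (suc b) (suc x) (suc y)
        ≡⟨ cong (λ s → F s (suc b) (suc x) (suc y)) (cong suc (ℕₚ.+-comm (suc b) c)) ⟩
      F (suc c ℕ.+ suc b) (suc b) (suc x) (suc y)
        ≡⟨ F-shear (suc c) (suc b) (suc x) (suc y) ⟩
      G (suc c) (suc b) (suc x) (suc x ℕ.+ suc y)
        ≡⟨ cong (λ s → G (suc c) (suc b) (suc x) (suc s)) (ℕₚ.+-suc x y) ⟩
      G (suc c) (suc b) (suc x) (suc (suc (x ℕ.+ y)))  ∎)

    -- Split by comparing a with b. On a = b = d the equation reads d (x + y) = n, so x and y
    -- decompose the codivisor m.
    S-F : S N n F ≡ + 2 * T + D N (λ d m → comp m (F d d)) n
    S-F = trans
      (∑∑-split N (λ a b → ∑∑ N λ x y → weight F a b x y)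
        (λ a b → trans (∑∑-comm N (weight F a b)) (∑∑-cong N λ x y → weight-sym F F-sym a b y x))
        (λ a b N≤a → ∑ᶻ-0 (upTo N) λ x → ∑ᶻ-0 (upTo N) λ y → weight-vanish F a b x y N≤a
          (ℕₚ.≤-trans (ℕₚ.n≤1+n a) (ℕₚ.≤-trans (ℕₚ.m≤m*n (suc a) (suc x)) (ℕₚ.m≤m+n (suc a ℕ.* suc x) (suc b ℕ.* suc y))))))
      (+-congˡ (+ 2 * T) (∑ᶻ-cong (upTo N) λ b → trans
        (∑∑-cong N λ x y → cong (λ s → δ s n * F (suc b) (suc b) (suc x) (suc y)) (sym (ℕₚ.*-distribˡ-+ (suc b) (suc x) (suc y))))
        (∑∑-comp N (λ s → δ (suc b ℕ.* s) n) (F (suc b) (suc b)) λ s N≤s → δ-vanish N≤s (ℕₚ.m≤n*m s (suc b)))))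

    -- Split by comparing x with y instead. On x = y = m the equation reads (a + b) m = n, so a and
    -- b decompose the divisor d.
    S-G : S N n G ≡ + 2 * T + D N (λ d m → comp d (λ a b → G a b m m)) n
    S-G = begin
      S N n G
        ≡⟨ ∑∑-fubini N (weight G) ⟩
      ∑∑ N (λ x y → ∑∑ N λ a b → weight G a b x y)
        ≡⟨ ∑∑-comm N (λ x y → ∑∑ N λ a b → weight G a b x y) ⟩
      ∑∑ N (λ y x → ∑∑ N λ a b → weight G a b x y)
        ≡⟨ ∑∑-split N (λ y x → ∑∑ N λ a b → weight G a b x y)
             (λ y x → trans (∑∑-comm N λ a b → weight G a b x y) (∑∑-cong N λ a b → weight-sym G G-sym b a x y))
             (λ y x N≤y → ∑ᶻ-0 (upTo N) λ a → ∑ᶻ-0 (upTo N) λ b → weight-vanish G a b x y N≤y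
               (ℕₚ.≤-trans (ℕₚ.n≤1+n y) (ℕₚ.≤-trans (ℕₚ.m≤n*m (suc y) (suc b)) (ℕₚ.m≤n+m (suc b ℕ.* suc y) (suc a ℕ.* suc x))))) ⟩
      + 2 * ∑∑ N (λ x e → ∑∑ N λ a b → weight G a b x (suc (x ℕ.+ e))) + ∑< N (λ x → ∑∑ N λ a b → weight G a b x x)
        ≡⟨ cong₂ (λ t d → + 2 * t + d) (sym T≡) (trans
             (∑ᶻ-cong (upTo N) diagonal)
             (∑∑-comm N λ x d → δ (suc d ℕ.* suc x) n * comp (suc d) (λ a b → G a b (suc x) (suc x)))) ⟩
      + 2 * T + D N (λ d m → comp d (λ a b → G a b m m)) n  ∎
      where
      T≡ : T ≡ ∑∑ N (λ x e → ∑∑ N λ a b → weight G a b x (suc (x ℕ.+ e)))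
      T≡ = begin
        T
          ≡⟨ ∑∑-cong N (λ b c → ∑∑-cong N λ x y → weight-shear b c x y) ⟩
        ∑∑ N (λ b c → ∑∑ N λ x y → weight G c b x (suc (x ℕ.+ y)))
          ≡⟨ ∑∑-fubini N (λ b c x y → weight G c b x (suc (x ℕ.+ y))) ⟩
        ∑∑ N (λ x y → ∑∑ N λ b c → weight G c b x (suc (x ℕ.+ y)))
          ≡⟨ ∑∑-cong N (λ x y → ∑∑-comm N λ b c → weight G c b x (suc (x ℕ.+ y))) ⟩
        ∑∑ N (λ x y → ∑∑ N λ a b → weight G a b x (suc (x ℕ.+ y)))  ∎
      diagonal : ∀ x → ∑∑ N (λ a b → weight G a b x x) ≡
                 ∑< N (λ d → δ (suc d ℕ.* suc x) n * comp (suc d) (λ a b → G a b (suc x) (suc x)))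
      diagonal x = trans
        (∑∑-cong N λ a b → cong (λ s → δ s n * G (suc a) (suc b) (suc x) (suc x)) (sym (ℕₚ.*-distribʳ-+ (suc x) (suc a) (suc b))))
        (∑∑-comp N (λ s → δ (s ℕ.* suc x) n) (λ a b → G a b (suc x) (suc x)) λ s N≤s → δ-vanish N≤s (ℕₚ.m≤m*n s (suc x)))

  -- For G = F + P the term 2T occurs in both `S-F` and `S-G`; it cancels and leaves the two
  -- boundary sums.
  S-telescope : ∀ N n → n < N → (F P : ℕ → ℕ → ℕ → ℕ → ℤ) →
    (∀ a b x y → F a b x y ≡ F b a y x) →
    (∀ a b x y → P a b x y ≡ P b a y x) →
    (∀ a b x y → F (a ℕ.+ b) b x y ≡ F a b x (x ℕ.+ y) + P a b x (x ℕ.+ y)) →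
    S N n P + D N (λ d m → comp m (F d d)) n ≡ D N (λ d m → comp d (λ a b → F (a ℕ.+ b) b m 0)) n
  S-telescope N n n<N F P F-sym P-sym shear = ∙-cancelˡ (+ 2 * T) (S N n P + Dᶠ) (D N sheared n) (begin
    + 2 * T + (S N n P + Dᶠ)  ≡⟨ rearrange (+ 2 * T) (S N n P) Dᶠ ⟩
    (+ 2 * T + Dᶠ) + S N n P  ≡⟨ cong (_+ S N n P) (sym S-F) ⟩
    S N n F + S N n P         ≡⟨ sym (S-+ N n F P) ⟩
    S N n (λ a b x y → F a b x y + P a b x y)  ≡⟨ S-G ⟩
    + 2 * T + D N (λ d m → comp d (λ a b → F a b m m + P a b m m)) n
      -- The shear equation at y = 0 merges F + P on the boundary x = y = m into the single value F
      -- (a + b) b m 0.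
      ≡⟨ +-congˡ (+ 2 * T) (D-cong N n (λ d m → comp d (λ a b → F a b m m + P a b m m)) sheared λ k l _ →
           comp-cong (suc k) λ a b → sym (trans (shear a b (suc l) 0)
           (cong (λ s → F a b (suc l) s + P a b (suc l) s) (ℕₚ.+-identityʳ (suc l))))) ⟩
    + 2 * T + D N sheared n  ∎)
    where
    open Telescoping N n n<N F (λ a b x y → F a b x y + P a b x y) F-sym
           (λ a b x y → cong₂ _+_ (F-sym a b x y) (P-sym a b x y)) shear
    sheared : ℕ → ℕ → ℤ
    sheared d m = comp d (λ a b → F (a ℕ.+ b) b m 0)
    Dᶠ : ℤ
    Dᶠ = D N (λ d m → comp m (F d d)) n
    rearrange : ∀ t s d → t + (s + d) ≡ (t + d) + s
    rearrange = solve 3 (λ t s d → t :+ (s :+ d) := (t :+ d) :+ s) refl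

  -- Convolution of sequences with constant term 1

  conv-cong : ∀ N n {u u′ v v′} → (∀ i → i < N → u i ≡ u′ i) → (∀ i → i < N → v i ≡ v′ i) →
              conv N u v n ≡ conv N u′ v′ n
  conv-cong N n u≡ v≡ = ∑<-cong N λ i i<N → ∑<-cong N λ j j<N →
    cong (δ (i ℕ.+ j) n *_) (cong₂ _*_ (u≡ i i<N) (v≡ j j<N))

  conv-comm : ∀ N n u v → conv N u v n ≡ conv N v u n
  conv-comm N n u v = trans (∑∑-comm N λ i j → δ (i ℕ.+ j) n * (u i * v j)) (∑∑-cong N λ i j →
    cong₂ (λ s p → δ s n * p) (ℕₚ.+-comm j i) (ℤₚ.*-comm (u j) (v i)))

  infixl 6 1+_
  -- `δ 0` is the unit of convolution, so this is the series 1 + u.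
  1+_ : (ℕ → ℤ) → ℕ → ℤ
  (1+ u) i = δ 0 i + u i

  conv-1+ˡ : ∀ N {n} u w → n < N → conv N (1+ u) w n ≡ w n + conv N u w n
  conv-1+ˡ N {n} u w n<N = begin
    conv N (1+ u) w n
      ≡⟨ ∑∑-cong N (λ i j → rearrange (δ (i ℕ.+ j) n) (δ 0 i) (u i) (w j)) ⟩
    ∑∑ N (λ i j → δ 0 i * (δ (i ℕ.+ j) n * w j) + δ (i ℕ.+ j) n * (u i * w j))
      ≡⟨ ∑∑-+ N (λ i j → δ 0 i * (δ (i ℕ.+ j) n * w j)) (λ i j → δ (i ℕ.+ j) n * (u i * w j)) ⟩
    ∑∑ N (λ i j → δ 0 i * (δ (i ℕ.+ j) n * w j)) + conv N u w n
      ≡⟨ cong (_+ conv N u w n) unit ⟩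
    w n + conv N u w n ∎
    where
    rearrange : ∀ d e u w → d * ((e + u) * w) ≡ e * (d * w) + d * (u * w)
    rearrange = solve 4 (λ d e u w → d :* ((e :+ u) :* w) := e :* (d :* w) :+ d :* (u :* w)) refl
    W : ℕ → ℤ
    W i = ∑< N λ j → δ (i ℕ.+ j) n * w j
    unit : ∑∑ N (λ i j → δ 0 i * (δ (i ℕ.+ j) n * w j)) ≡ w n
    unit = begin
      ∑∑ N (λ i j → δ 0 i * (δ (i ℕ.+ j) n * w j))
        ≡⟨ ∑ᶻ-cong (upTo N) (λ i → ∑ᶻ-*ˡ (upTo N) (δ 0 i) λ j → δ (i ℕ.+ j) n * w j) ⟩
      ∑< N (λ i → δ 0 i * W i)
        ≡⟨ ∑<-δ N 0 W (λ i N≤i → ∑ᶻ-0 (upTo N) λ j → trans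
             (cong (_* w j) (δ-> (i ℕ.+ j) n (ℕₚ.<-≤-trans n<N (ℕₚ.≤-trans N≤i (ℕₚ.m≤m+n i j)))))
             (ℤₚ.*-zeroˡ (w j))) ⟩
      W 0
        ≡⟨ ∑<-δʳ w n<N ⟩
      w n ∎

  conv-1+ : ∀ N {n} u v → n < N → conv N (1+ u) (1+ v) n ≡ δ 0 n + (u n + v n + conv N u v n)
  conv-1+ N {n} u v n<N = begin
    conv N (1+ u) (1+ v) n                 ≡⟨ conv-1+ˡ N u (1+ v) n<N ⟩
    (δ 0 n + v n) + conv N u (1+ v) n      ≡⟨ +-congˡ (δ 0 n + v n) (trans (conv-comm N n u (1+ v)) (conv-1+ˡ N v u n<N)) ⟩
    (δ 0 n + v n) + (u n + conv N v u n)   ≡⟨ cong (λ c → (δ 0 n + v n) + (u n + c)) (conv-comm N n v u) ⟩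
    (δ 0 n + v n) + (u n + conv N u v n)   ≡⟨ rearrange (δ 0 n) (u n) (v n) (conv N u v n) ⟩
    δ 0 n + (u n + v n + conv N u v n)     ∎
    where
    rearrange : ∀ e u v c → (e + v) + (u + c) ≡ e + (u + v + c)
    rearrange = solve 4 (λ e u v c → (e :+ v) :+ (u :+ c) := e :+ (u :+ v :+ c)) refl

  -- Boundary sums of polynomial functions

  ε : ℕ → ℤ
  ε m = -1ℤ ^ m

  ε-+ : ∀ x y → ε (x ℕ.+ y) ≡ ε x * ε y
  ε-+ = ℤₚ.^-distribˡ-+-* -1ℤ

  -- Replacing y by x + y therefore exchanges (-1)^y and (-1)^(x + y); this is the exchange of h and
  -- z in the shear equation of a certificate.
  ε-x+x+y : ∀ x y → ε (x ℕ.+ (x ℕ.+ y)) ≡ ε y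
  ε-x+x+y zero    y = refl
  ε-x+x+y (suc x) y = begin
    -1ℤ * ε (x ℕ.+ suc (x ℕ.+ y))    ≡⟨ cong (λ s → -1ℤ * ε s) (ℕₚ.+-suc x (x ℕ.+ y)) ⟩
    -1ℤ * (-1ℤ * ε (x ℕ.+ (x ℕ.+ y)))  ≡⟨ rearrange (ε (x ℕ.+ (x ℕ.+ y))) ⟩
    ε (x ℕ.+ (x ℕ.+ y))              ≡⟨ ε-x+x+y x y ⟩
    ε y                              ∎
    where
    rearrange : ∀ e → -1ℤ * (-1ℤ * e) ≡ e
    rearrange = solve 1 (λ e → con -1ℤ :* (con -1ℤ :* e) := e) refl

  -- The sum of (-1)^x over 0 < x < m is - (1 + (-1)^m) / 2. The factor 2 in 2c keeps the
  -- telescoping primitive c ((-1)^y - (-1)^x) integral.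
  comp-ε : ∀ k c {φ} → (∀ x y → φ x y ≡ + 2 * c * (ε x + ε y)) → comp (suc k) φ ≡ - (+ 2 * c) * (1ℤ + ε (suc k))
  comp-ε k c {φ} eq = trans
    (comp-telescope k (λ x y → c * (ε y - ε x)) λ x y → trans (eq (suc x) (suc y)) (step c (ε x) (ε y)))
    (total c (ε k))
    where
    step : ∀ c e h → + 2 * c * (-1ℤ * e + -1ℤ * h) ≡ c * (-1ℤ * h - e) - c * (h - -1ℤ * e)
    step = solve 3 (λ c e h → con (+ 2) :* c :* (con -1ℤ :* e :+ con -1ℤ :* h)
      := c :* (con -1ℤ :* h :- e) :- c :* (h :- con -1ℤ :* e)) refl
    total : ∀ c e → c * (e - 1ℤ) - c * (1ℤ - e) ≡ - (+ 2 * c) * (1ℤ + -1ℤ * e)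
    total = solve 2 (λ c e → c :* (e :- con 1ℤ) :- c :* (con 1ℤ :- e) := :- (con (+ 2) :* c) :* (con 1ℤ :+ con -1ℤ :* e)) refl

  -- Substitution into polynomial expressions

  infix 10 _[_]
  _[_] : ∀ {m n} → Polynomial m → Vec (Polynomial n) m → Polynomial n
  op o p q [ θ ] = op o (p [ θ ]) (q [ θ ])
  con c    [ θ ] = con c
  var x    [ θ ] = lookup θ x
  (p :^ k) [ θ ] = (p [ θ ]) :^ k
  (:- p)   [ θ ] = :- (p [ θ ])

  ⟦_⟧* : ∀ {m n} → Vec (Polynomial n) m → Vec ℤ n → Vec ℤ m
  ⟦ θ ⟧* ρ = Vec.map (λ p → ⟦ p ⟧ ρ) θ

  -- Carries identities checked on substituted polynomials over to values at the substituted
  -- arguments.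
  ⟦[]⟧ : ∀ {m n} (p : Polynomial m) (θ : Vec (Polynomial n) m) ρ → ⟦ p [ θ ] ⟧ ρ ≡ ⟦ p ⟧ (⟦ θ ⟧* ρ)
  ⟦[]⟧ (op o p q) θ ρ = cong₂ (sem o) (⟦[]⟧ p θ ρ) (⟦[]⟧ q θ ρ)
  ⟦[]⟧ (con c)    θ ρ = refl
  ⟦[]⟧ (var x)    θ ρ = sym (lookup-map x (λ p → ⟦ p ⟧ ρ) θ)
  ⟦[]⟧ (p :^ k)   θ ρ = cong (λ z → ⟦ var 0F :^ k ⟧ (z ∷ [])) (⟦[]⟧ p θ ρ)
  ⟦[]⟧ (:- p)     θ ρ = cong -_ (⟦[]⟧ p θ ρ)

  -- Normal forms are compared, rather than values: the definition of integer
  -- multiplication duplicates its arguments, so unfolding values is exponential.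
  infix 4 _≈ᴾ_
  _≈ᴾ_ : ∀ {n} → Polynomial n → Polynomial n → Set
  p ≈ᴾ q = normalise p ≡ normalise q

  ≈ᴾ⇒≡ : ∀ {n} (p q : Polynomial n) → p ≈ᴾ q → ∀ ρ → ⟦ p ⟧ ρ ≡ ⟦ q ⟧ ρ
  ≈ᴾ⇒≡ p q eq ρ = prove ρ p q (cong (λ N → ⟦ N ⟧N ρ) eq)

  -- The variables e, h and z stand for (-1)^x, (-1)^y and (-1)^(x + y); the identities
  -- are linear in them, so the relation z = e h is not needed.  The boundary x = y
  -- contributes the sum over a + b = d of p (d , b), for which R is a telescoping
  -- primitive, the boundary a = b the multiple c of (-1)^x + (-1)^y; together they
  -- leave s (d , (-1)^m) for each factorisation dm = n.
  record Certificate (p q : Polynomial 5) (c : Polynomial 1) (R : Polynomial 3) (s : Polynomial 2) : Set where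
    constructor certificate
    field
      p-sym : let a = var 0F; b = var 1F; e = var 2F; h = var 3F; z = var 4F in
        p ≈ᴾ p [ b ∷ a ∷ h ∷ e ∷ z ∷ [] ]
      q-sym : let a = var 0F; b = var 1F; e = var 2F; h = var 3F; z = var 4F in
        q ≈ᴾ q [ b ∷ a ∷ h ∷ e ∷ z ∷ [] ]
      shear : let a = var 0F; b = var 1F; e = var 2F; h = var 3F; z = var 4F
                  θ : Vec (Polynomial 5) 5; θ = a ∷ b ∷ e ∷ z ∷ h ∷ [] in
        p [ a :+ b ∷ b ∷ e ∷ h ∷ z ∷ [] ] ≈ᴾ p [ θ ] :+ q [ θ ]
      diagonal : let d = var {4} 0F; e = var 1F; h = var 2F; z = var 3F in
        p [ d ∷ d ∷ e ∷ h ∷ z ∷ [] ] ≈ᴾ con (+ 2) :* c [ d ∷ [] ] :* (e :+ h)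
      step : let a = var {3} 0F; b = var 1F; e = var 2F; 1+a = con 1ℤ :+ a; 1+b = con 1ℤ :+ b in
        p [ 1+a :+ 1+b ∷ 1+b ∷ e ∷ con 1ℤ ∷ e ∷ [] ] ≈ᴾ R [ a ∷ 1+b ∷ e ∷ [] ] :- R [ 1+a ∷ b ∷ e ∷ [] ]
      total : let k = var {2} 0F; e = var 1F; 1+k = con 1ℤ :+ k in
        R [ con 0ℤ ∷ k ∷ e ∷ [] ] :- R [ k ∷ con 0ℤ ∷ e ∷ [] ] ≈ᴾ
        s [ 1+k ∷ e ∷ [] ] :+ :- (con (+ 2) :* c [ 1+k ∷ [] ]) :* (con 1ℤ :+ e)

  -- `S-telescope` with `p` as F and `q` as P. For each factorisation dm = n the boundary x = y
  -- equals `s` plus the boundary a = b, so the sum `Dᶠ` of the latter cancels.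
  S-closed : ∀ N n → n < N → ∀ {p q c R s} → Certificate p q c R s →
    S N n (λ a b x y → ⟦ q ⟧ (+ a ∷ + b ∷ ε x ∷ ε y ∷ ε (x ℕ.+ y) ∷ [])) ≡ D N (λ d m → ⟦ s ⟧ (+ d ∷ ε m ∷ [])) n
  S-closed N n n<N {p} {q} {c} {R} {s} cert =
    ∙-cancelʳ Dᶠ (S N n Q) (D N (λ d m → ⟦ s ⟧ (+ d ∷ ε m ∷ [])) n) (begin
      S N n Q + Dᶠ
        ≡⟨ S-telescope N n n<N F Q (sym-at p p-sym) (sym-at q q-sym) shear-at ⟩
      D N (λ d m → comp d (λ a b → F (a ℕ.+ b) b m 0)) n
        ≡⟨ D-cong N n (λ d m → comp d (λ a b → F (a ℕ.+ b) b m 0))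
                      (λ d m → ⟦ s ⟧ (+ d ∷ ε m ∷ []) + comp m (F d d)) (λ k l _ → pointwise k l) ⟩
      D N (λ d m → ⟦ s ⟧ (+ d ∷ ε m ∷ []) + comp m (F d d)) n
        ≡⟨ D-+ N n (λ d m → ⟦ s ⟧ (+ d ∷ ε m ∷ [])) (λ d m → comp m (F d d)) ⟩
      D N (λ d m → ⟦ s ⟧ (+ d ∷ ε m ∷ [])) n + Dᶠ  ∎)
    where
    open Certificate cert
    ρ : ℕ → ℕ → ℕ → ℕ → Vec ℤ 5
    ρ a b x y = + a ∷ + b ∷ ε x ∷ ε y ∷ ε (x ℕ.+ y) ∷ []
    F Q : ℕ → ℕ → ℕ → ℕ → ℤ
    F a b x y = ⟦ p ⟧ (ρ a b x y)
    Q a b x y = ⟦ q ⟧ (ρ a b x y)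
    Dᶠ : ℤ
    Dᶠ = D N (λ d m → comp m (F d d)) n
    swap : Vec (Polynomial 5) 5
    swap = var 1F ∷ var 0F ∷ var 3F ∷ var 2F ∷ var 4F ∷ []
    sym-at : ∀ r → r ≈ᴾ r [ swap ] → ∀ a b x y → ⟦ r ⟧ (ρ a b x y) ≡ ⟦ r ⟧ (ρ b a y x)
    sym-at r r-sym a b x y = begin
      ⟦ r ⟧ (ρ a b x y)           ≡⟨ ≈ᴾ⇒≡ r (r [ swap ]) r-sym (ρ a b x y) ⟩
      ⟦ r [ swap ] ⟧ (ρ a b x y)  ≡⟨ ⟦[]⟧ r swap (ρ a b x y) ⟩
      ⟦ r ⟧ (+ b ∷ + a ∷ ε y ∷ ε x ∷ ε (x ℕ.+ y) ∷ [])
        ≡⟨ cong (λ k → ⟦ r ⟧ (+ b ∷ + a ∷ ε y ∷ ε x ∷ ε k ∷ [])) (ℕₚ.+-comm x y) ⟩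
      ⟦ r ⟧ (ρ b a y x)           ∎
    shear-at : ∀ a b x y → F (a ℕ.+ b) b x y ≡ F a b x (x ℕ.+ y) + Q a b x (x ℕ.+ y)
    shear-at a b x y = begin
      F (a ℕ.+ b) b x y
        ≡⟨ sym (⟦[]⟧ p θ (ρ a b x y)) ⟩
      ⟦ p [ θ ] ⟧ (ρ a b x y)
        ≡⟨ ≈ᴾ⇒≡ (p [ θ ]) (p [ τ ] :+ q [ τ ]) shear (ρ a b x y) ⟩
      ⟦ p [ τ ] ⟧ (ρ a b x y) + ⟦ q [ τ ] ⟧ (ρ a b x y)
        ≡⟨ cong₂ _+_ (τ-at p) (τ-at q) ⟩
      F a b x (x ℕ.+ y) + Q a b x (x ℕ.+ y)  ∎
      where
      θ τ : Vec (Polynomial 5) 5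
      θ = var 0F :+ var 1F ∷ var 1F ∷ var 2F ∷ var 3F ∷ var 4F ∷ []
      τ = var 0F ∷ var 1F ∷ var 2F ∷ var 4F ∷ var 3F ∷ []
      τ-at : ∀ r → ⟦ r [ τ ] ⟧ (ρ a b x y) ≡ ⟦ r ⟧ (ρ a b x (x ℕ.+ y))
      τ-at r = trans (⟦[]⟧ r τ (ρ a b x y))
        (cong (λ w → ⟦ r ⟧ (+ a ∷ + b ∷ ε x ∷ ε (x ℕ.+ y) ∷ w ∷ [])) (sym (ε-x+x+y x y)))
    pointwise : ∀ k l → comp (suc k) (λ a b → F (a ℕ.+ b) b (suc l) 0) ≡
                        ⟦ s ⟧ (+ suc k ∷ ε (suc l) ∷ []) + comp (suc l) (F (suc k) (suc k))
    pointwise k l = begin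
      comp (suc k) (λ a b → F (a ℕ.+ b) b (suc l) 0)
        ≡⟨ comp-telescope k (λ a b → ⟦ R ⟧ (+ a ∷ + b ∷ e ∷ [])) step-at ⟩
      ⟦ R ⟧ (0ℤ ∷ + k ∷ e ∷ []) - ⟦ R ⟧ (+ k ∷ 0ℤ ∷ e ∷ [])
        ≡⟨ cong₂ _-_ (sym (⟦[]⟧ R (con 0ℤ ∷ K ∷ E ∷ []) (+ k ∷ e ∷ [])))
                     (sym (⟦[]⟧ R (K ∷ con 0ℤ ∷ E ∷ []) (+ k ∷ e ∷ []))) ⟩
      ⟦ R [ con 0ℤ ∷ K ∷ E ∷ [] ] ⟧ (+ k ∷ e ∷ []) - ⟦ R [ K ∷ con 0ℤ ∷ E ∷ [] ] ⟧ (+ k ∷ e ∷ [])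
        ≡⟨ ≈ᴾ⇒≡ (R [ con 0ℤ ∷ K ∷ E ∷ [] ] :- R [ K ∷ con 0ℤ ∷ E ∷ [] ])
                (s [ 1+K ∷ E ∷ [] ] :+ :- (con (+ 2) :* c [ 1+K ∷ [] ]) :* (con 1ℤ :+ E)) total (+ k ∷ e ∷ []) ⟩
      ⟦ s [ 1+K ∷ E ∷ [] ] ⟧ (+ k ∷ e ∷ []) + - (+ 2 * ⟦ c [ 1+K ∷ [] ] ⟧ (+ k ∷ e ∷ [])) * (1ℤ + e)
        ≡⟨ cong₂ (λ u v → u + - (+ 2 * v) * (1ℤ + e))
             (⟦[]⟧ s (1+K ∷ E ∷ []) (+ k ∷ e ∷ [])) (⟦[]⟧ c (1+K ∷ []) (+ k ∷ e ∷ [])) ⟩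
      ⟦ s ⟧ (+ suc k ∷ e ∷ []) + - (+ 2 * ⟦ c ⟧ (+ suc k ∷ [])) * (1ℤ + e)
        ≡⟨ +-congˡ (⟦ s ⟧ (+ suc k ∷ e ∷ [])) (sym (comp-ε l (⟦ c ⟧ (+ suc k ∷ [])) diagonal-at)) ⟩
      ⟦ s ⟧ (+ suc k ∷ e ∷ []) + comp (suc l) (F (suc k) (suc k))  ∎
      where
      e : ℤ
      e = ε (suc l)
      K E 1+K : Polynomial 2
      K = var 0F
      E = var 1F
      1+K = con 1ℤ :+ K
      step-at : ∀ a b → F (suc a ℕ.+ suc b) (suc b) (suc l) 0 ≡ ⟦ R ⟧ (+ a ∷ + suc b ∷ e ∷ []) - ⟦ R ⟧ (+ suc a ∷ + b ∷ e ∷ [])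
      step-at a b = begin
        F (suc a ℕ.+ suc b) (suc b) (suc l) 0
          -- At y = 0 the sign (-1)^y is 1 and (-1)^(x + y) is (-1)^x; these fill the last two
          -- places of `θ`.
          ≡⟨ cong (λ m → ⟦ p ⟧ (+ (suc a ℕ.+ suc b) ∷ + suc b ∷ e ∷ 1ℤ ∷ ε m ∷ [])) (ℕₚ.+-identityʳ (suc l)) ⟩
        ⟦ p ⟧ (⟦ θ ⟧* (+ a ∷ + b ∷ e ∷ []))
          ≡⟨ sym (⟦[]⟧ p θ (+ a ∷ + b ∷ e ∷ [])) ⟩
        ⟦ p [ θ ] ⟧ (+ a ∷ + b ∷ e ∷ [])
          ≡⟨ ≈ᴾ⇒≡ (p [ θ ]) (R [ τ₁ ] :- R [ τ₂ ]) step (+ a ∷ + b ∷ e ∷ []) ⟩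
        ⟦ R [ τ₁ ] ⟧ (+ a ∷ + b ∷ e ∷ []) - ⟦ R [ τ₂ ] ⟧ (+ a ∷ + b ∷ e ∷ [])
          ≡⟨ cong₂ _-_ (⟦[]⟧ R τ₁ (+ a ∷ + b ∷ e ∷ [])) (⟦[]⟧ R τ₂ (+ a ∷ + b ∷ e ∷ [])) ⟩
        ⟦ R ⟧ (+ a ∷ + suc b ∷ e ∷ []) - ⟦ R ⟧ (+ suc a ∷ + b ∷ e ∷ [])  ∎
        where
        1+A 1+B : Polynomial 3
        1+A = con 1ℤ :+ var 0F
        1+B = con 1ℤ :+ var 1F
        θ : Vec (Polynomial 3) 5
        θ = 1+A :+ 1+B ∷ 1+B ∷ var 2F ∷ con 1ℤ ∷ var 2F ∷ []
        τ₁ τ₂ : Vec (Polynomial 3) 3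
        τ₁ = var 0F ∷ 1+B ∷ var 2F ∷ []
        τ₂ = 1+A ∷ var 1F ∷ var 2F ∷ []
      diagonal-at : ∀ x y → F (suc k) (suc k) x y ≡ + 2 * ⟦ c ⟧ (+ suc k ∷ []) * (ε x + ε y)
      diagonal-at x y = begin
        F (suc k) (suc k) x y
          ≡⟨ sym (⟦[]⟧ p θ ρ₄) ⟩
        ⟦ p [ θ ] ⟧ ρ₄
          ≡⟨ ≈ᴾ⇒≡ (p [ θ ]) (con (+ 2) :* c [ var 0F ∷ [] ] :* (var 1F :+ var 2F)) diagonal ρ₄ ⟩
        + 2 * ⟦ c [ var 0F ∷ [] ] ⟧ ρ₄ * (ε x + ε y)
          ≡⟨ cong (λ v → + 2 * v * (ε x + ε y)) (⟦[]⟧ c (var 0F ∷ []) ρ₄) ⟩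
        + 2 * ⟦ c ⟧ (+ suc k ∷ []) * (ε x + ε y)  ∎
        where
        ρ₄ : Vec ℤ 4
        ρ₄ = + suc k ∷ ε x ∷ ε y ∷ ε (x ℕ.+ y) ∷ []
        θ : Vec (Polynomial 4) 5
        θ = var 0F ∷ var 0F ∷ var 1F ∷ var 2F ∷ var 3F ∷ []

  -- The certificates of weight 4 and 8

  module Weight₄ where
    private
      a b e h z : Polynomial 5
      a = var 0F; b = var 1F; e = var 2F; h = var 3F; z = var 4F

    opaque
      -- The shear permutes the squares together with their signs, except that (a + b)² meets (a -
      -- b)²; the difference 4ab gives 4 · 144 = 576.
      p q : Polynomial 5
      p = con (+ 144) :* (e :* b :^ 2 :+ h :* a :^ 2 :+ z :* (a :- b) :^ 2)
      q = con (+ 576) :* z :* a :* b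

      c : Polynomial 1
      c = con (+ 72) :* var 0F :^ 2

      -- Faulhaber's formula, with s = k (k + 1) and t = 2k + 1.
      R : Polynomial 3
      R = con (+ 144) :* d :^ 2 :* k :* (con 1ℤ :+ e₃)
          :+ e₃ :* (con (+ 48) :* s :* t :- con (+ 144) :* d :* s)
        where
        e₃ k d s t : Polynomial 3
        e₃ = var 2F
        k = var 1F
        -- Both instances of `R` in `step` give a + b + 2 here, so `d` stays fixed while `R` sums
        -- the boundary values over 1 ≤ b ≤ k.
        d = var 0F :+ k :+ con 1ℤ
        s = k :* (k :+ con 1ℤ)
        t = con (+ 2) :* k :+ con 1ℤ

      s : Polynomial 2
      s = (con (+ 144) :+ con (+ 96) :* var 1F) :* var 0F :^ 3 :+ con (+ 48) :* var 1F :* var 0F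

      cert : Certificate p q c R s
      cert = certificate refl refl refl refl refl refl

  module Weight₈ where
    private
      a b e h z : Polynomial 5
      a = var 0F; b = var 1F; e = var 2F; h = var 3F; z = var 4F

      -- Let q₁ = 864 a³b³ - 372 ab⁵ be the coefficient of (-1)^x in q / 16.  The shear
      -- equation asks for f(a + b , b) - f(a , b) = q₁ and p-sym for f(b - a , b) = f(a , b),
      -- so for even f the odd part in a is - q₁ / 2; the even part is then determined up to
      -- a multiple of b⁶, which the coefficient of (-1)^(x + y) fixes.
      f : Polynomial 5 → Polynomial 5 → Polynomial 5
      f a b = con (+ 216) :* (a :* b :* (a :- b)) :^ 2 :+ con (+ 186) :* a :* (b :- a) :* b :^ 4
              :- con (+ 63) :* b :^ 6

    opaque
      -- `q` is the summand of (24 ĥ)⁴ - 2 (24 ĥ) (8 t̃), symmetrised. The sign-free part of `p`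
      -- uses (ab(a + b))² - (ab(a - b))² = 4a³b³, with 16 · 324 · 4 = 2304 · 9.
      p q : Polynomial 5
      p = con (+ 16) :* (con (+ 324) :* (a :* b :* (a :- b)) :^ 2
                         :+ e :* f a b :+ h :* f b a :+ z :* f a (a :- b))
      q = con (+ 2304) :* (con (+ 9) :+ con (+ 6) :* e :+ con (+ 6) :* h :+ con (+ 4) :* z) :* (a :* b) :^ 3
          :- con (+ 192) :* ((con (+ 31) :* e :+ con (+ 32) :* z) :* a :* b :^ 5
                             :+ (con (+ 31) :* h :+ con (+ 32) :* z) :* a :^ 5 :* b)

      -- At a = b only the term - 63 b⁶ of `f` survives, and f(d , 0) = 0 removes the sign z; 16 ·
      -- (-63) = 2 · (-504).
      c : Polynomial 1
      c = con (- + 504) :* var 0F :^ 6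

      -- Faulhaber's formulas for the powers up to 6, with s = k (k + 1) and t = 2k + 1.
      R : Polynomial 3
      R = con (+ 8) :*
        ((con (+ 118) :+ con (+ 77) :* e₃) :* d :^ 4 :* s :* t
         :- (con (+ 540) :+ con (+ 360) :* e₃) :* d :^ 3 :* s :^ 2
         :+ (con (+ 36) :+ con (+ 3) :* e₃) :* d :^ 2 :* s :* t :* (con (+ 3) :* s :- con 1ℤ)
         :+ (con (+ 186) :+ con (+ 192) :* e₃) :* d :^ 5 :* s
         :- con (+ 126) :* (con 1ℤ :+ e₃) :* d :^ 6 :* k
         :+ con (+ 63) :* e₃ :* d :* s :^ 2 :* (con (+ 2) :* s :- con 1ℤ)
         :- con (+ 6) :* e₃ :* s :* t :* (con (+ 3) :* s :^ 2 :- con (+ 3) :* s :+ con 1ℤ))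
        where
        e₃ k d s t : Polynomial 3
        e₃ = var 2F
        k = var 1F
        d = var 0F :+ k :+ con 1ℤ
        s = k :* (k :+ con 1ℤ)
        t = con (+ 2) :* k :+ con 1ℤ

      s : Polynomial 2
      s = con (- + 16) :* ((con (+ 14) :+ con (+ 16) :* e₂) :* d :^ 7
        :+ con (+ 6) :* (con (+ 3) :+ con (+ 2) :* e₂) :* d :^ 3
        :+ con (+ 3) :* e₂ :* d :+ (con (+ 31) :+ con (+ 32) :* e₂) :* d :^ 5)
        where
        d e₂ : Polynomial 2
        d = var 0F
        e₂ = var 1F

      cert : Certificate p q c R s
      cert = certificate refl refl refl refl refl refl

  -- The convolution identities

  term : Polynomial 2 → ℕ → ℕ → ℤ
  term r d m = ⟦ r ⟧ (+ d ∷ ε m ∷ [])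

  D-≈ᴾ : ∀ N n r s → r ≈ᴾ s → D N (term r) n ≡ D N (term s) n
  D-≈ᴾ N n r s eq = D-cong N n (term r) (term s) λ k l _ → ≈ᴾ⇒≡ r s eq (+ suc k ∷ ε (suc l) ∷ [])

  infixl 8 _⊗_
  _⊗_ : Polynomial 2 → Polynomial 2 → Polynomial 4
  r ⊗ s = r [ var 0F ∷ var 2F ∷ [] ] :* s [ var 1F ∷ var 3F ∷ [] ]

  ⊗-correct : ∀ r s a b x y → ⟦ r ⊗ s ⟧ (+ a ∷ + b ∷ ε x ∷ ε y ∷ []) ≡ term r a x * term s b y
  ⊗-correct r s a b x y = cong₂ _*_ (⟦[]⟧ r (var 0F ∷ var 2F ∷ []) ρ) (⟦[]⟧ s (var 1F ∷ var 3F ∷ []) ρ)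
    where
    ρ : Vec ℤ 4
    ρ = + a ∷ + b ∷ ε x ∷ ε y ∷ []

  -- Imposes z = e h, that is (-1)^(x + y) = (-1)^x (-1)^y, under which the certified `q` become
  -- combinations of products of summands.
  multiplicative : Vec (Polynomial 4) 5
  multiplicative = var 0F ∷ var 1F ∷ var 2F ∷ var 3F ∷ var 2F :* var 3F ∷ []

  S⊗ : ℕ → ℕ → Polynomial 2 → Polynomial 2 → ℤ
  S⊗ N n r s = S N n λ a b x y → term r a x * term s b y

  S-multiplicative : ∀ N n (q : Polynomial 5) →
    S N n (λ a b x y → ⟦ q [ multiplicative ] ⟧ (+ a ∷ + b ∷ ε x ∷ ε y ∷ [])) ≡
    S N n (λ a b x y → ⟦ q ⟧ (+ a ∷ + b ∷ ε x ∷ ε y ∷ ε (x ℕ.+ y) ∷ []))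
  S-multiplicative N n q = S-cong N n λ a b x y → trans
    (⟦[]⟧ q multiplicative (+ a ∷ + b ∷ ε x ∷ ε y ∷ []))
    (cong (λ z → ⟦ q ⟧ (+ a ∷ + b ∷ ε x ∷ ε y ∷ z ∷ [])) (sym (ε-+ x y)))

  opaque
    -- The sums of hᴾ, tᴾ and bᴾ in d and (-1)^m over dm = n are the coefficients of
    -- 24 ĥ, 8 t̃ and 576 ĥ²; that of σᴾ is 32 σ₇(n) when n, hence every m, is odd.
    hᴾ tᴾ bᴾ σᴾ : Polynomial 2
    hᴾ = con (- + 24) :* var 1F :* var 0F
    tᴾ = con (- + 8) :* (con (+ 31) :+ con (+ 32) :* var 1F) :* var 0F :^ 5
    bᴾ = con (+ 48) :* (con (+ 3) :+ con (+ 2) :* var 1F) :* var 0F :^ 3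
    σᴾ = con (- + 32) :* (con (+ 7) :+ con (+ 8) :* var 1F) :* var 0F :^ 7

  opaque
    unfolding hᴾ Weight₄.q Weight₈.q
    hh≈ : hᴾ ⊗ hᴾ ≈ᴾ Weight₄.q [ multiplicative ]
    hh≈ = refl
    -- The cross terms of (1 + u)² cancel the linear part of `Weight₄.s`, leaving pure cubes.
    hhs≈b : hᴾ :+ hᴾ :+ Weight₄.s ≈ᴾ bᴾ
    hhs≈b = refl
    bb≈ : bᴾ ⊗ bᴾ ≈ᴾ Weight₈.q [ multiplicative ] :+ (hᴾ ⊗ tᴾ :+ tᴾ ⊗ hᴾ)
    bb≈ = refl
    -- In `Weight₈.s` the cubic part cancels 2 `bᴾ`, the linear and quintic parts are 2 `hᴾ` and 2
    -- `tᴾ`, and the part of degree 7 is `σᴾ`.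
    bbs≈ : bᴾ :+ bᴾ :+ Weight₈.s ≈ᴾ (σᴾ :+ (hᴾ :+ hᴾ)) :+ (tᴾ :+ tᴾ)
    bbs≈ = refl

  module _ (N : ℕ) where
    Ĥ T̃ B̂ : ℕ → ℤ
    Ĥ = 1+ D N (term hᴾ)
    T̃ = 1+ D N (term tᴾ)
    B̂ = 1+ D N (term bᴾ)

    conv-D-term : ∀ r s {n} → n < N → conv N (D N (term r)) (D N (term s)) n ≡ S⊗ N n r s
    conv-D-term r s = conv-D N (term r) (term s)

    S-hh : ∀ {n} → n < N → S⊗ N n hᴾ hᴾ ≡ D N (term Weight₄.s) n
    S-hh {n} n<N = begin
      S⊗ N n hᴾ hᴾ
        ≡⟨ S-cong N n (λ a b x y → trans (sym (⊗-correct hᴾ hᴾ a b x y))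
             (≈ᴾ⇒≡ (hᴾ ⊗ hᴾ) (Weight₄.q [ multiplicative ]) hh≈ (+ a ∷ + b ∷ ε x ∷ ε y ∷ []))) ⟩
      S N n (λ a b x y → ⟦ Weight₄.q [ multiplicative ] ⟧ (+ a ∷ + b ∷ ε x ∷ ε y ∷ []))
        ≡⟨ S-multiplicative N n Weight₄.q ⟩
      S N n (λ a b x y → ⟦ Weight₄.q ⟧ (+ a ∷ + b ∷ ε x ∷ ε y ∷ ε (x ℕ.+ y) ∷ []))
        ≡⟨ S-closed N n n<N Weight₄.cert ⟩
      D N (term Weight₄.s) n  ∎

    -- In (1 + u)² = 1 + 2u + u² the term u² is the divisor sum from the weight 4 certificate, so
    -- the square has the same shape as its factors and can be squared again.
    conv-ĤĤ : ∀ {n} → n < N → conv N Ĥ Ĥ n ≡ B̂ n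
    conv-ĤĤ {n} n<N = begin
      conv N Ĥ Ĥ n
        ≡⟨ conv-1+ N (D N (term hᴾ)) (D N (term hᴾ)) n<N ⟩
      δ 0 n + (D N (term hᴾ) n + D N (term hᴾ) n + conv N (D N (term hᴾ)) (D N (term hᴾ)) n)
        ≡⟨ +-congˡ (δ 0 n) (begin
             D N (term hᴾ) n + D N (term hᴾ) n + conv N (D N (term hᴾ)) (D N (term hᴾ)) n
               ≡⟨ cong₂ _+_ (sym (D-+ N n (term hᴾ) (term hᴾ))) (trans (conv-D-term hᴾ hᴾ n<N) (S-hh n<N)) ⟩
             D N (term (hᴾ :+ hᴾ)) n + D N (term Weight₄.s) n
               ≡⟨ sym (D-+ N n (term (hᴾ :+ hᴾ)) (term Weight₄.s)) ⟩
             D N (term (hᴾ :+ hᴾ :+ Weight₄.s)) n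
               ≡⟨ D-≈ᴾ N n (hᴾ :+ hᴾ :+ Weight₄.s) bᴾ hhs≈b ⟩
             D N (term bᴾ) n  ∎) ⟩
      δ 0 n + D N (term bᴾ) n  ∎

    -- The certificate evaluates only the difference; the mixed sums stay, to be absorbed into the
    -- convolution of `Ĥ` and `T̃`.
    S-bb : ∀ {n} → n < N → S⊗ N n bᴾ bᴾ ≡ D N (term Weight₈.s) n + (S⊗ N n hᴾ tᴾ + S⊗ N n tᴾ hᴾ)
    S-bb {n} n<N = begin
      S⊗ N n bᴾ bᴾ
        ≡⟨ S-cong N n (λ a b x y → let ρ = + a ∷ + b ∷ ε x ∷ ε y ∷ [] in begin
             term bᴾ a x * term bᴾ b y
               ≡⟨ sym (⊗-correct bᴾ bᴾ a b x y) ⟩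
             ⟦ bᴾ ⊗ bᴾ ⟧ ρ
               ≡⟨ ≈ᴾ⇒≡ (bᴾ ⊗ bᴾ) (Weight₈.q [ multiplicative ] :+ (hᴾ ⊗ tᴾ :+ tᴾ ⊗ hᴾ)) bb≈ ρ ⟩
             ⟦ Weight₈.q [ multiplicative ] ⟧ ρ + (⟦ hᴾ ⊗ tᴾ ⟧ ρ + ⟦ tᴾ ⊗ hᴾ ⟧ ρ)
               ≡⟨ +-congˡ (⟦ Weight₈.q [ multiplicative ] ⟧ ρ) (cong₂ _+_ (⊗-correct hᴾ tᴾ a b x y) (⊗-correct tᴾ hᴾ a b x y)) ⟩
             ⟦ Weight₈.q [ multiplicative ] ⟧ ρ + (term hᴾ a x * term tᴾ b y + term tᴾ a x * term hᴾ b y)  ∎) ⟩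
      S N n (λ a b x y → Q a b x y + (term hᴾ a x * term tᴾ b y + term tᴾ a x * term hᴾ b y))
        ≡⟨ S-+ N n Q (λ a b x y → term hᴾ a x * term tᴾ b y + term tᴾ a x * term hᴾ b y) ⟩
      S N n Q + S N n (λ a b x y → term hᴾ a x * term tᴾ b y + term tᴾ a x * term hᴾ b y)
        ≡⟨ cong₂ _+_ (trans (S-multiplicative N n Weight₈.q) (S-closed N n n<N Weight₈.cert))
             (S-+ N n (λ a b x y → term hᴾ a x * term tᴾ b y) (λ a b x y → term tᴾ a x * term hᴾ b y)) ⟩
      D N (term Weight₈.s) n + (S⊗ N n hᴾ tᴾ + S⊗ N n tᴾ hᴾ)  ∎
      where
      Q : ℕ → ℕ → ℕ → ℕ → ℤ
      Q a b x y = ⟦ Weight₈.q [ multiplicative ] ⟧ (+ a ∷ + b ∷ ε x ∷ ε y ∷ [])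

    -- By `bbs≈` the divisor sums supply 2h + 2t; with the two equal mixed sums they form 2 (1 +
    -- h)(1 + t) at a positive index, where the constant 1 contributes nothing.
    conv-B̂B̂ : ∀ {n} → suc n < N → conv N B̂ B̂ (suc n) ≡ D N (term σᴾ) (suc n) + + 2 * conv N Ĥ T̃ (suc n)
    conv-B̂B̂ {n′} n<N = begin
      conv N B̂ B̂ n
        ≡⟨ trans (conv-1+ N (Dᵗ bᴾ) (Dᵗ bᴾ) n<N) (ℤₚ.+-identityˡ (Dᵗ bᴾ n + Dᵗ bᴾ n + conv N (Dᵗ bᴾ) (Dᵗ bᴾ) n)) ⟩
      Dᵗ bᴾ n + Dᵗ bᴾ n + conv N (Dᵗ bᴾ) (Dᵗ bᴾ) n
        ≡⟨ +-congˡ (Dᵗ bᴾ n + Dᵗ bᴾ n) (trans (conv-D-term bᴾ bᴾ n<N) (S-bb n<N)) ⟩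
      Dᵗ bᴾ n + Dᵗ bᴾ n + (Dᵗ Weight₈.s n + (S⊗ N n hᴾ tᴾ + S⊗ N n tᴾ hᴾ))
        ≡⟨ sym (ℤₚ.+-assoc (Dᵗ bᴾ n + Dᵗ bᴾ n) (Dᵗ Weight₈.s n) (S⊗ N n hᴾ tᴾ + S⊗ N n tᴾ hᴾ)) ⟩
      Dᵗ bᴾ n + Dᵗ bᴾ n + Dᵗ Weight₈.s n + (S⊗ N n hᴾ tᴾ + S⊗ N n tᴾ hᴾ)
        ≡⟨ cong₂ _+_ D-part (+-congˡ (S⊗ N n hᴾ tᴾ) S-tᴾhᴾ) ⟩
      (Dᵗ σᴾ n + (Dᵗ hᴾ n + Dᵗ hᴾ n)) + (Dᵗ tᴾ n + Dᵗ tᴾ n) + (S⊗ N n hᴾ tᴾ + S⊗ N n hᴾ tᴾ)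
        ≡⟨ rearrange (Dᵗ σᴾ n) (Dᵗ hᴾ n) (Dᵗ tᴾ n) (S⊗ N n hᴾ tᴾ) ⟩
      Dᵗ σᴾ n + + 2 * (Dᵗ hᴾ n + Dᵗ tᴾ n + S⊗ N n hᴾ tᴾ)
        ≡⟨ cong (λ w → Dᵗ σᴾ n + + 2 * w) (begin
             Dᵗ hᴾ n + Dᵗ tᴾ n + S⊗ N n hᴾ tᴾ
               ≡⟨ +-congˡ (Dᵗ hᴾ n + Dᵗ tᴾ n) (sym (conv-D-term hᴾ tᴾ n<N)) ⟩
             Dᵗ hᴾ n + Dᵗ tᴾ n + conv N (Dᵗ hᴾ) (Dᵗ tᴾ) n
               ≡⟨ sym (trans (conv-1+ N (Dᵗ hᴾ) (Dᵗ tᴾ) n<N) (ℤₚ.+-identityˡ (Dᵗ hᴾ n + Dᵗ tᴾ n + conv N (Dᵗ hᴾ) (Dᵗ tᴾ) n))) ⟩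
             conv N Ĥ T̃ n  ∎) ⟩
      Dᵗ σᴾ n + + 2 * conv N Ĥ T̃ n  ∎
      where
      n : ℕ
      n = suc n′
      Dᵗ : Polynomial 2 → ℕ → ℤ
      Dᵗ r = D N (term r)
      S-tᴾhᴾ : S⊗ N n tᴾ hᴾ ≡ S⊗ N n hᴾ tᴾ
      S-tᴾhᴾ = trans (sym (conv-D-term tᴾ hᴾ n<N))
                     (trans (conv-comm N n (Dᵗ tᴾ) (Dᵗ hᴾ)) (conv-D-term hᴾ tᴾ n<N))
      D-:+ : ∀ r s → Dᵗ (r :+ s) n ≡ Dᵗ r n + Dᵗ s n
      D-:+ r s = D-+ N n (term r) (term s)
      D-part : Dᵗ bᴾ n + Dᵗ bᴾ n + Dᵗ Weight₈.s n ≡ (Dᵗ σᴾ n + (Dᵗ hᴾ n + Dᵗ hᴾ n)) + (Dᵗ tᴾ n + Dᵗ tᴾ n)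
      D-part = begin
        Dᵗ bᴾ n + Dᵗ bᴾ n + Dᵗ Weight₈.s n
          ≡⟨ cong (_+ Dᵗ Weight₈.s n) (sym (D-:+ bᴾ bᴾ)) ⟩
        Dᵗ (bᴾ :+ bᴾ) n + Dᵗ Weight₈.s n
          ≡⟨ sym (D-:+ (bᴾ :+ bᴾ) Weight₈.s) ⟩
        Dᵗ (bᴾ :+ bᴾ :+ Weight₈.s) n
          ≡⟨ D-≈ᴾ N n (bᴾ :+ bᴾ :+ Weight₈.s) ((σᴾ :+ (hᴾ :+ hᴾ)) :+ (tᴾ :+ tᴾ)) bbs≈ ⟩
        Dᵗ ((σᴾ :+ (hᴾ :+ hᴾ)) :+ (tᴾ :+ tᴾ)) n
          ≡⟨ D-:+ (σᴾ :+ (hᴾ :+ hᴾ)) (tᴾ :+ tᴾ) ⟩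
        Dᵗ (σᴾ :+ (hᴾ :+ hᴾ)) n + Dᵗ (tᴾ :+ tᴾ) n
          ≡⟨ cong₂ _+_ (D-:+ σᴾ (hᴾ :+ hᴾ)) (D-:+ tᴾ tᴾ) ⟩
        (Dᵗ σᴾ n + Dᵗ (hᴾ :+ hᴾ) n) + (Dᵗ tᴾ n + Dᵗ tᴾ n)
          ≡⟨ cong (λ w → (Dᵗ σᴾ n + w) + (Dᵗ tᴾ n + Dᵗ tᴾ n)) (D-:+ hᴾ hᴾ) ⟩
        (Dᵗ σᴾ n + (Dᵗ hᴾ n + Dᵗ hᴾ n)) + (Dᵗ tᴾ n + Dᵗ tᴾ n)  ∎
      rearrange : ∀ d h t s → (d + (h + h)) + (t + t) + (s + s) ≡ d + + 2 * (h + t + s)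
      rearrange = solve 4 (λ d h t s → (d :+ (h :+ h)) :+ (t :+ t) :+ (s :+ s) := d :+ con (+ 2) :* (h :+ t :+ s)) refl

  -- Divisor sums

  if-Dec : ∀ {P : Set} (P? : Dec P) {x y : ℤ} → (P → x ≡ y) → (¬ P → 0ℤ ≡ y) → (if does P? then x else 0ℤ) ≡ y
  if-Dec (yes p) eq _  = eq p
  if-Dec (no ¬p) _  eq = eq ¬p

  -- For fixed d the inner sum over m meets only the codivisor of d if d divides i, and is zero
  -- otherwise.
  ∑-divisors-D : ∀ N {i} .{{_ : NonZero i}} → i < N → (f : (d : ℕ) → .{{NonZero d}} → ℤ) (g : ℕ → ℕ → ℤ) →
                 (∀ k l → suc k ℕ.* suc l ≡ i → f (suc k) ≡ g (suc k) (suc l)) →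
                 ∑-divisors i f ≡ D N g i
  ∑-divisors-D N {suc i′} i<N f g f≡g = begin
    ∑-divisors i f
      ≡⟨ ∑ᶻ-foldr (upTo i) (λ k → if does (suc k ∣? i) then f (suc k) else 0ℤ) ⟩
    ∑< i (λ k → if does (suc k ∣? i) then f (suc k) else 0ℤ)
      ≡⟨ ∑ᶻ-cong (upTo i) (λ k → if-Dec (suc k ∣? i) (divisor k) (nondivisor k)) ⟩
    ∑< i row
      ≡⟨ sym (∑<-extend row (ℕₚ.<⇒≤ i<N) λ k i≤k → nondivisor-row k λ l eq →
           ℕₚ.<⇒≢ (ℕₚ.<-≤-trans (s≤s i≤k) (ℕₚ.m≤m*n (suc k) (suc l))) (sym eq)) ⟩
    ∑< N row  ∎
    where
    i : ℕ
    i = suc i′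
    row : ℕ → ℤ
    row k = ∑< N λ l → δ (suc k ℕ.* suc l) i * g (suc k) (suc l)
    nondivisor-row : ∀ k → (∀ l → suc k ℕ.* suc l ≢ i) → row k ≡ 0ℤ
    nondivisor-row k ≢i = ∑ᶻ-0 (upTo N) λ l →
      trans (cong (_* g (suc k) (suc l)) (δ-≢ (suc k ℕ.* suc l) i (≢i l))) (ℤₚ.*-zeroˡ (g (suc k) (suc l)))
    nondivisor : ∀ k → ¬ suc k ∣ i → 0ℤ ≡ row k
    nondivisor k ∤i = sym (nondivisor-row k λ l eq → ∤i (subst (suc k ∣_) eq (m∣m*n (suc l))))
    divisor : ∀ k → suc k ∣ i → f (suc k) ≡ row k
    divisor k (divides (suc l) i≡) = begin
      f (suc k)
        ≡⟨ f≡g k l kl≡i ⟩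
      g (suc k) (suc l)
        ≡⟨ sym (∑<-δʳ (λ l → g (suc k) (suc l)) l<N) ⟩
      ∑< N (λ l′ → δ l′ l * g (suc k) (suc l′))
        ≡⟨ ∑ᶻ-cong (upTo N) (λ l′ → cong (_* g (suc k) (suc l′)) (δ-codivisor l′)) ⟩
      row k  ∎
      where
      kl≡i : suc k ℕ.* suc l ≡ i
      kl≡i = trans (ℕₚ.*-comm (suc k) (suc l)) (sym i≡)
      l<N : l < N
      l<N = ℕₚ.<-≤-trans (subst (l <_) kl≡i (ℕₚ.m≤n*m (suc l) (suc k))) (ℕₚ.<⇒≤ i<N)
      δ-codivisor : ∀ l′ → δ l′ l ≡ δ (suc k ℕ.* suc l′) i
      δ-codivisor l′ = δ-⇔ l′ l (suc k ℕ.* suc l′) i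
        (λ l′≡l → trans (cong (λ j → suc k ℕ.* suc j) l′≡l) kl≡i)
        (λ eq → ℕₚ.suc-injective (ℕₚ.*-cancelˡ-≡ (suc l′) (suc l) (suc k) (trans eq (sym kl≡i))))

  -- 1 + (-1)^j is 2 for even j and 0 for odd j, hence an induction in steps of two. Arguments
  -- beyond the range on the left contribute zero on the right.
  ∑<-even : ∀ N (f : ℕ → ℤ) → VanishesFrom N f →
            ∑< N (λ k → (1ℤ + ε (suc k)) * f (suc k)) ≡ + 2 * ∑< N (λ k → f (2 ℕ.* suc k))
  ∑<-even zero          f vf = refl
  ∑<-even (suc zero)    f vf = sym (trans (cong (λ z → + 2 * (z + 0ℤ)) (vf 2 (s≤s z≤n)))
                                          (sym (trans (ℤₚ.+-identityʳ (0ℤ * f 1)) (ℤₚ.*-zeroˡ (f 1)))))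
  ∑<-even (suc (suc N)) f vf = begin
    ∑< (suc (suc N)) (λ k → (1ℤ + ε (suc k)) * f (suc k))
      ≡⟨ trans (∑<-suc (suc N) (λ k → (1ℤ + ε (suc k)) * f (suc k)))
               (+-congˡ (0ℤ * f 1) (∑<-suc N (λ k → (1ℤ + ε (suc (suc k))) * f (suc (suc k))))) ⟩
    0ℤ * f 1 + (+ 2 * f 2 + ∑< N (λ k → (1ℤ + ε (suc (suc (suc k)))) * f″ (suc k)))
      ≡⟨ cong₂ (λ u v → u + (+ 2 * f 2 + v)) (ℤₚ.*-zeroˡ (f 1))
           (trans (∑ᶻ-cong (upTo N) λ k → cong (λ e → (1ℤ + e) * f″ (suc k)) (ε-+2 (suc k))) (∑<-even N f″ vf″)) ⟩
    0ℤ + (+ 2 * f 2 + + 2 * ∑< N (λ k → f″ (2 ℕ.* suc k)))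
      ≡⟨ trans (ℤₚ.+-identityˡ _) (sym (ℤₚ.*-distribˡ-+ (+ 2) (f 2) (∑< N λ k → f″ (2 ℕ.* suc k)))) ⟩
    + 2 * (f 2 + ∑< N (λ k → f″ (2 ℕ.* suc k)))
      ≡⟨ cong (λ w → + 2 * (f 2 + w)) (trans
           (∑ᶻ-cong (upTo N) λ k → cong f (sym (ℕₚ.*-suc 2 (suc k))))
           (sym (∑<-extend (λ k → f (2 ℕ.* suc (suc k))) (ℕₚ.n≤1+n N) λ k N≤k →
             vf (2 ℕ.* suc (suc k)) (ℕₚ.≤-trans (s≤s (s≤s N≤k)) (ℕₚ.m≤n*m (suc (suc k)) 2))))) ⟩
    + 2 * (f 2 + ∑< (suc N) (λ k → f (2 ℕ.* suc (suc k))))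
      ≡⟨ cong (+ 2 *_) (sym (∑<-suc (suc N) λ k → f (2 ℕ.* suc k))) ⟩
    + 2 * ∑< (suc (suc N)) (λ k → f (2 ℕ.* suc k))  ∎
    where
    f″ : ℕ → ℤ
    f″ k = f (suc (suc k))
    vf″ : VanishesFrom N f″
    vf″ k N≤k = vf (suc (suc k)) (s≤s (s≤s N≤k))
    ε-+2 : ∀ k → ε (suc (suc k)) ≡ ε k
    ε-+2 k = ε-x+x+y 1 k

  *-^-distrib : ∀ i j s → (i * j) ^ s ≡ i ^ s * j ^ s
  *-^-distrib i j zero    = refl
  *-^-distrib i j (suc s) = trans (cong (i * j *_) (*-^-distrib i j s)) (rearrange i j (i ^ s) (j ^ s))
    where
    rearrange : ∀ a b c d → a * b * (c * d) ≡ a * c * (b * d)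
    rearrange = solve 4 (λ a b c d → a :* b :* (c :* d) := a :* c :* (b :* d)) refl

  -- An even divisor d = 2d′ with dm = n corresponds to d′ (2m) = n: the factor 2 passes to the
  -- codivisor, at the price of 2^s.
  D-double : ∀ N {n} → n < N → ∀ s →
             D N (λ d m → (1ℤ + ε d) * (+ d) ^ s) n ≡ (+ 2) ^ s * D N (λ d m → (1ℤ + ε m) * (+ d) ^ s) n
  D-double N {n} n<N s = begin
    D N (λ d m → (1ℤ + ε d) * (+ d) ^ s) n
      ≡⟨ ∑∑-comm N (λ k l → δ (suc k ℕ.* suc l) n * ((1ℤ + ε (suc k)) * (+ suc k) ^ s)) ⟩
    ∑∑ N (λ l k → δ (suc k ℕ.* suc l) n * ((1ℤ + ε (suc k)) * (+ suc k) ^ s))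
      ≡⟨ ∑ᶻ-cong (upTo N) (λ l → trans
           (∑ᶻ-cong (upTo N) λ k → rearrange (δ (suc k ℕ.* suc l) n) (1ℤ + ε (suc k)) ((+ suc k) ^ s))
           (∑<-even N (λ j → δ (j ℕ.* suc l) n * (+ j) ^ s) λ j N≤j →
             vanish (j ℕ.* suc l) ((+ j) ^ s) (ℕₚ.≤-trans N≤j (ℕₚ.m≤m*n j (suc l))))) ⟩
    ∑< N (λ l → + 2 * ∑< N (λ k → δ (2 ℕ.* suc k ℕ.* suc l) n * (+ (2 ℕ.* suc k)) ^ s))
      ≡⟨ ∑ᶻ-*ˡ (upTo N) (+ 2) (λ l → ∑< N (λ k → δ (2 ℕ.* suc k ℕ.* suc l) n * (+ (2 ℕ.* suc k)) ^ s)) ⟩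
    + 2 * ∑∑ N (λ l k → δ (2 ℕ.* suc k ℕ.* suc l) n * (+ (2 ℕ.* suc k)) ^ s)
      ≡⟨ cong (+ 2 *_) (trans (∑∑-comm N (λ l k → δ (2 ℕ.* suc k ℕ.* suc l) n * (+ (2 ℕ.* suc k)) ^ s))
           (∑∑-cong N λ k l → trans (cong₂ (λ u v → δ u n * v) (shift k l) (power k))
             (rearrange (δ (suc k ℕ.* (2 ℕ.* suc l)) n) ((+ 2) ^ s) ((+ suc k) ^ s)))) ⟩
    + 2 * ∑∑ N (λ k l → (+ 2) ^ s * (δ (suc k ℕ.* (2 ℕ.* suc l)) n * (+ suc k) ^ s))
      ≡⟨ trans (cong (+ 2 *_) (∑∑-*ˡ N ((+ 2) ^ s) (λ k l → δ (suc k ℕ.* (2 ℕ.* suc l)) n * (+ suc k) ^ s)))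
               (rearrange (+ 2) ((+ 2) ^ s) (∑∑ N (λ k l → δ (suc k ℕ.* (2 ℕ.* suc l)) n * (+ suc k) ^ s))) ⟩
    (+ 2) ^ s * (+ 2 * ∑∑ N (λ k l → δ (suc k ℕ.* (2 ℕ.* suc l)) n * (+ suc k) ^ s))
      ≡⟨ cong ((+ 2) ^ s *_) (sym (∑ᶻ-*ˡ (upTo N) (+ 2) λ k → ∑< N λ l → δ (suc k ℕ.* (2 ℕ.* suc l)) n * (+ suc k) ^ s)) ⟩
    (+ 2) ^ s * ∑< N (λ k → + 2 * ∑< N (λ l → δ (suc k ℕ.* (2 ℕ.* suc l)) n * (+ suc k) ^ s))
      ≡⟨ cong ((+ 2) ^ s *_) (∑ᶻ-cong (upTo N) λ k → trans
           (sym (∑<-even N (λ j → δ (suc k ℕ.* j) n * (+ suc k) ^ s) λ j N≤j →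
             vanish (suc k ℕ.* j) ((+ suc k) ^ s) (ℕₚ.≤-trans N≤j (ℕₚ.m≤n*m j (suc k)))))
           (∑ᶻ-cong (upTo N) λ l → sym (rearrange (δ (suc k ℕ.* suc l) n) (1ℤ + ε (suc l)) ((+ suc k) ^ s)))) ⟩
    (+ 2) ^ s * D N (λ d m → (1ℤ + ε m) * (+ d) ^ s) n  ∎
    where
    rearrange : ∀ a b c → a * (b * c) ≡ b * (a * c)
    rearrange = solve 3 (λ a b c → a :* (b :* c) := b :* (a :* c)) refl
    vanish : ∀ t x → N ≤ t → δ t n * x ≡ 0ℤ
    vanish t x N≤t = trans (cong (_* x) (δ-> t n (ℕₚ.<-≤-trans n<N N≤t))) (ℤₚ.*-zeroˡ x)
    shift : ∀ k l → 2 ℕ.* suc k ℕ.* suc l ≡ suc k ℕ.* (2 ℕ.* suc l)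
    shift k l = trans (cong (ℕ._* suc l) (ℕₚ.*-comm 2 (suc k))) (ℕₚ.*-assoc (suc k) 2 (suc l))
    power : ∀ k → (+ (2 ℕ.* suc k)) ^ s ≡ (+ 2) ^ s * (+ suc k) ^ s
    power k = trans (cong (_^ s) (ℤₚ.pos-* 2 (suc k))) (*-^-distrib (+ 2) (+ suc k) s)

  ε-odd : ∀ m → 2 ∤ m → ε m ≡ -1ℤ
  ε-odd zero          2∤m = contradiction (divides 0 refl) 2∤m
  ε-odd (suc zero)    2∤m = refl
  ε-odd (suc (suc m)) 2∤m = trans (ε-x+x+y 1 m) (ε-odd m λ { (divides q eq) → 2∤m (divides (suc q) (cong (suc ∘ suc) eq)) })

  -- The arithmetic functions as sums over dm = n

  opaque
    unfolding hᴾ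
    term-hᴾ : ∀ d m → term hᴾ d m ≡ - + 24 * ε m * + d
    term-hᴾ d m = refl
    term-tᴾ : ∀ d m → term tᴾ d m ≡ - + 8 * (+ 31 + + 32 * ε m) * (+ d) ^ 5
    term-tᴾ d m = refl
    term-σᴾ : ∀ d m → term σᴾ d m ≡ - + 32 * (+ 7 + + 8 * ε m) * (+ d) ^ 7
    term-σᴾ d m = refl

  -- The constant terms are 24 · 1/24 and 8 · 1/8.
  24ĥ 8t̃ : ℕ → ℤ
  24ĥ zero    = 1ℤ
  24ĥ (suc i) = + 24 * σ̂ (suc i)
  8t̃ zero    = 1ℤ
  8t̃ (suc i) = + 8 * σ̃ 5 (suc i)

  module _ (N : ℕ) where
    -- On dm = i the quotient i / d is m, and (-1)^(m - 1) = - (-1)^m gives the sign in `hᴾ`.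
    24σ̂≡D : ∀ {i} .{{_ : NonZero i}} → i < N → + 24 * σ̂ i ≡ D N (term hᴾ) i
    24σ̂≡D {i} i<N = begin
      + 24 * σ̂ i
        ≡⟨ cong (+ 24 *_) (∑-divisors-D N i<N (λ d → (-1ℤ ^ (i / d ∸ 1)) * + d) (λ d m → ε (m ∸ 1) * + d)
             λ k l kl≡i → cong (λ m → ε (m ∸ 1) * + suc k) (quotient k l kl≡i)) ⟩
      + 24 * D N (λ d m → ε (m ∸ 1) * + d) i
        ≡⟨ sym (D-*ˡ N i (+ 24) (λ d m → ε (m ∸ 1) * + d)) ⟩
      D N (λ d m → + 24 * (ε (m ∸ 1) * + d)) i
        ≡⟨ D-cong N i (λ d m → + 24 * (ε (m ∸ 1) * + d)) (term hᴾ) (λ k l _ →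
             trans (rearrange (ε l) (+ suc k)) (sym (term-hᴾ (suc k) (suc l)))) ⟩
      D N (term hᴾ) i  ∎
      where
      rearrange : ∀ e d → + 24 * (e * d) ≡ - + 24 * (-1ℤ * e) * d
      rearrange = solve 2 (λ e d → con (+ 24) :* (e :* d) := con (- + 24) :* (con -1ℤ :* e) :* d) refl
      quotient : ∀ k l → suc k ℕ.* suc l ≡ i → i / suc k ≡ suc l
      quotient k l refl = trans (cong (_/ suc k) (ℕₚ.*-comm (suc k) (suc l))) (m*n/n≡m (suc l) (suc k))

    -- Since (-1)^(d - 1) = 1 - (1 + (-1)^d), D-double moves the sign from d to m.
    8σ̃₅≡D : ∀ {i} .{{_ : NonZero i}} → i < N → + 8 * σ̃ 5 i ≡ D N (term tᴾ) i
    8σ̃₅≡D {i} i<N = ∙-cancelʳ (+ 8 * D N even i) (+ 8 * σ̃ 5 i) (D N (term tᴾ) i) (begin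
      + 8 * σ̃ 5 i + + 8 * D N even i
        ≡⟨ cong (λ s → + 8 * s + + 8 * D N even i)
             (∑-divisors-D N i<N (λ d → (-1ℤ ^ (d ∸ 1)) * (+ d) ^ 5) g λ k l _ → refl) ⟩
      + 8 * D N g i + + 8 * D N even i
        ≡⟨ cong₂ _+_ (sym (D-*ˡ N i (+ 8) g)) (sym (D-*ˡ N i (+ 8) even)) ⟩
      D N (λ d m → + 8 * g d m) i + D N (λ d m → + 8 * even d m) i
        ≡⟨ sym (D-+ N i (λ d m → + 8 * g d m) (λ d m → + 8 * even d m)) ⟩
      D N (λ d m → + 8 * g d m + + 8 * even d m) i
        -- 32 = 2⁵ is the factor from `D-double`, and 1 - 32 (1 + (-1)^m) = - (31 + 32 (-1)^m) is
        -- the coefficient in `tᴾ`.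
        ≡⟨ D-cong N i (λ d m → + 8 * g d m + + 8 * even d m) (λ d m → term tᴾ d m + + 8 * (+ 32 * even′ d m)) (λ k l _ →
             trans (rearrange (ε k) (ε l) ((+ suc k) ^ 5))
                   (cong (_+ + 8 * (+ 32 * even′ (suc k) (suc l))) (sym (term-tᴾ (suc k) (suc l))))) ⟩
      D N (λ d m → term tᴾ d m + + 8 * (+ 32 * even′ d m)) i
        ≡⟨ D-+ N i (term tᴾ) (λ d m → + 8 * (+ 32 * even′ d m)) ⟩
      D N (term tᴾ) i + D N (λ d m → + 8 * (+ 32 * even′ d m)) i
        ≡⟨ +-congˡ (D N (term tᴾ) i) (begin
             D N (λ d m → + 8 * (+ 32 * even′ d m)) i  ≡⟨ D-*ˡ N i (+ 8) (λ d m → + 32 * even′ d m) ⟩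
             + 8 * D N (λ d m → + 32 * even′ d m) i    ≡⟨ cong (+ 8 *_) (D-*ˡ N i (+ 32) even′) ⟩
             + 8 * (+ 32 * D N even′ i)                ≡⟨ cong (+ 8 *_) (sym (D-double N i<N 5)) ⟩
             + 8 * D N even i                          ∎) ⟩
      D N (term tᴾ) i + + 8 * D N even i  ∎)
      where
      g even even′ : ℕ → ℕ → ℤ
      g     d m = ε (d ∸ 1) * (+ d) ^ 5
      even  d m = (1ℤ + ε d) * (+ d) ^ 5
      even′ d m = (1ℤ + ε m) * (+ d) ^ 5
      rearrange : ∀ e h p → + 8 * (e * p) + + 8 * ((1ℤ + -1ℤ * e) * p) ≡
                  - + 8 * (+ 31 + + 32 * (-1ℤ * h)) * p + + 8 * (+ 32 * ((1ℤ + -1ℤ * h) * p))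
      rearrange = solve 3 (λ e h p →
        con (+ 8) :* (e :* p) :+ con (+ 8) :* ((con 1ℤ :+ con -1ℤ :* e) :* p) :=
        con (- + 8) :* (con (+ 31) :+ con (+ 32) :* (con -1ℤ :* h)) :* p
          :+ con (+ 8) :* (con (+ 32) :* ((con 1ℤ :+ con -1ℤ :* h) :* p))) refl

    -- Oddness of n enters here: every codivisor m is odd, and 7 + 8 (-1) = -1.
    32σ₇≡D : ∀ {n} .{{_ : NonZero n}} → n < N → 2 ∤ n → + 32 * σ 7 n ≡ D N (term σᴾ) n
    32σ₇≡D {n} n<N 2∤n = begin
      + 32 * σ 7 n
        ≡⟨ cong (+ 32 *_) (∑-divisors-D N n<N (λ d → (+ d) ^ 7) (λ d m → (+ d) ^ 7) λ k l _ → refl) ⟩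
      + 32 * D N (λ d m → (+ d) ^ 7) n
        ≡⟨ sym (D-*ˡ N n (+ 32) (λ d m → (+ d) ^ 7)) ⟩
      D N (λ d m → + 32 * (+ d) ^ 7) n
        ≡⟨ D-cong N n (λ d m → + 32 * (+ d) ^ 7) (term σᴾ) (λ k l kl≡n → sym (begin
             term σᴾ (suc k) (suc l)
               ≡⟨ term-σᴾ (suc k) (suc l) ⟩
             - + 32 * (+ 7 + + 8 * ε (suc l)) * (+ suc k) ^ 7
               ≡⟨ cong (λ e → - + 32 * (+ 7 + + 8 * e) * (+ suc k) ^ 7)
                    (ε-odd (suc l) λ 2∣l → 2∤n (subst (2 ∣_) kl≡n (∣-trans 2∣l (n∣m*n (suc k))))) ⟩
             + 32 * (+ suc k) ^ 7  ∎)) ⟩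
      D N (term σᴾ) n  ∎

    -- A product of successors is never 0, so each δ computes to zero.
    D-0 : ∀ f → D N f 0 ≡ 0ℤ
    D-0 f = trans (∑∑-cong N λ k l → ℤₚ.*-zeroˡ (f (suc k) (suc l)))
      (trans (∑∑-*ˡ N 0ℤ λ _ _ → 0ℤ) (ℤₚ.*-zeroˡ (∑∑ N λ _ _ → 0ℤ)))

    24ĥ≡Ĥ : ∀ i → i < N → 24ĥ i ≡ Ĥ N i
    24ĥ≡Ĥ zero    _   = sym (+-congˡ 1ℤ (D-0 (term hᴾ)))
    24ĥ≡Ĥ (suc i) i<N = trans (24σ̂≡D i<N) (sym (ℤₚ.+-identityˡ (D N (term hᴾ) (suc i))))

    8t̃≡T̃ : ∀ i → i < N → 8t̃ i ≡ T̃ N i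
    8t̃≡T̃ zero    _   = sym (+-congˡ 1ℤ (D-0 (term tᴾ)))
    8t̃≡T̃ (suc i) i<N = trans (8σ̃₅≡D i<N) (sym (ℤₚ.+-identityˡ (D N (term tᴾ) (suc i))))

    -- The theorem multiplied by 32 and cleared of denominators: 24⁴ = 32 · 12 · 864 and 2 · 24 · 8
    -- = 32 · 12.
    fourfold-convolution : ∀ {n} .{{_ : NonZero n}} → n < N → 2 ∤ n →
           conv N (conv N 24ĥ 24ĥ) (conv N 24ĥ 24ĥ) n ≡ + 32 * σ 7 n + + 2 * conv N 24ĥ 8t̃ n
    fourfold-convolution {suc n} n<N 2∤n = begin
      conv N (conv N 24ĥ 24ĥ) (conv N 24ĥ 24ĥ) (suc n)
        ≡⟨ conv-cong N (suc n) square≡ square≡ ⟩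
      conv N (B̂ N) (B̂ N) (suc n)
        ≡⟨ conv-B̂B̂ N n<N ⟩
      D N (term σᴾ) (suc n) + + 2 * conv N (Ĥ N) (T̃ N) (suc n)
        ≡⟨ cong₂ (λ u v → u + + 2 * v) (sym (32σ₇≡D n<N 2∤n)) (sym (conv-cong N (suc n) 24ĥ≡Ĥ 8t̃≡T̃)) ⟩
      + 32 * σ 7 (suc n) + + 2 * conv N 24ĥ 8t̃ (suc n)  ∎
      where
      square≡ : ∀ i → i < N → conv N 24ĥ 24ĥ i ≡ B̂ N i
      square≡ i i<N = trans (conv-cong N i 24ĥ≡Ĥ 24ĥ≡Ĥ) (conv-ĤĤ N i<N)

-- Passage to the rational numbers

open import Data.Rational using (_+_; _*_; _-_; _/_)

-- `fromℤ` reduces to lowest terms; comparison with the plain fraction z / 1 brings sums and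
-- products down to integer arithmetic.
fromℤ-unnormalised : ∀ z → ℚ.toℚᵘ (fromℤ z) ℚᵘ.≃ ℚᵘ.mkℚᵘ z 0
fromℤ-unnormalised z = ℚₚ.toℚᵘ-fromℚᵘ (ℚᵘ.mkℚᵘ z 0)

fromℤ-+ : ∀ x y → fromℤ (x ℤ.+ y) ≡ fromℤ x + fromℤ y
fromℤ-+ x y = ℚₚ.toℚᵘ-injective (begin
  ℚ.toℚᵘ (fromℤ (x ℤ.+ y))    ≈⟨ fromℤ-unnormalised (x ℤ.+ y) ⟩
  ℚᵘ.mkℚᵘ (x ℤ.+ y) 0       ≈⟨ ℚᵘ.*≡* (cong (ℤ._* 1ℤ) (cong₂ ℤ._+_ (sym (ℤₚ.*-identityʳ x)) (sym (ℤₚ.*-identityʳ y)))) ⟩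
  ℚᵘ.mkℚᵘ x 0 ℚᵘ.+ ℚᵘ.mkℚᵘ y 0   ≈⟨ ℚᵘₚ.+-cong (ℚᵘₚ.≃-sym (fromℤ-unnormalised x)) (ℚᵘₚ.≃-sym (fromℤ-unnormalised y)) ⟩
  ℚ.toℚᵘ (fromℤ x) ℚᵘ.+ ℚ.toℚᵘ (fromℤ y)  ≈⟨ ℚᵘₚ.≃-sym (ℚₚ.toℚᵘ-homo-+ (fromℤ x) (fromℤ y)) ⟩
  ℚ.toℚᵘ (fromℤ x + fromℤ y)  ∎)
  where open import Relation.Binary.Reasoning.Setoid ℚᵘₚ.≃-setoid

fromℤ-* : ∀ x y → fromℤ (x ℤ.* y) ≡ fromℤ x * fromℤ y
fromℤ-* x y = ℚₚ.toℚᵘ-injective (begin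
  ℚ.toℚᵘ (fromℤ (x ℤ.* y))    ≈⟨ fromℤ-unnormalised (x ℤ.* y) ⟩
  ℚᵘ.mkℚᵘ x 0 ℚᵘ.* ℚᵘ.mkℚᵘ y 0   ≈⟨ ℚᵘₚ.*-cong (ℚᵘₚ.≃-sym (fromℤ-unnormalised x)) (ℚᵘₚ.≃-sym (fromℤ-unnormalised y)) ⟩
  ℚ.toℚᵘ (fromℤ x) ℚᵘ.* ℚ.toℚᵘ (fromℤ y)  ≈⟨ ℚᵘₚ.≃-sym (ℚₚ.toℚᵘ-homo-* (fromℤ x) (fromℤ y)) ⟩
  ℚ.toℚᵘ (fromℤ x * fromℤ y)  ∎)
  where open import Relation.Binary.Reasoning.Setoid ℚᵘₚ.≃-setoid

∑-fromℤ : ∀ {A : Set} (xs : List A) {f : A → ℚ} (g : A → ℤ) c →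
          (∀ x → f x ≡ fromℤ (g x) * c) → ∑ xs f ≡ fromℤ (∑ᶻ xs g) * c
∑-fromℤ []       g c eq = sym (ℚₚ.*-zeroˡ c)
∑-fromℤ (x ∷ xs) g c eq = trans (cong₂ _+_ (eq x) (∑-fromℤ xs g c eq))
  (trans (sym (ℚₚ.*-distribʳ-+ c (fromℤ (g x)) (fromℤ (∑ᶻ xs g)))) (cong (_* c) (sym (fromℤ-+ (g x) (∑ᶻ xs g)))))

∑-pairs : ∀ n u v → ∑ᶻ (pairs n) (λ (i , j) → u i ℤ.* v j) ≡ conv (suc n) u v n
∑-pairs n u v = trans
  (∑ᶻ-filter (λ (i , j) → i ℕ.+ j ℕ.≟ n) (cartesianProduct r r) (λ (i , j) → u i ℤ.* v j))
  (∑ᶻ-cartesianProduct r r (λ (i , j) → δ (i ℕ.+ j) n ℤ.* (u i ℤ.* v j)))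
  where
  r : List ℕ
  r = upTo (suc n)

∑-quadruples : ∀ n u → ∑ᶻ (quadruples n) (λ (i , j , k , l) → (u i ℤ.* u j) ℤ.* (u k ℤ.* u l)) ≡
               conv (suc n) (conv (suc n) u u) (conv (suc n) u u) n
∑-quadruples n u = begin
  ∑ᶻ (quadruples n) f
    ≡⟨ ∑ᶻ-filter (λ (i , j , k , l) → i ℕ.+ j ℕ.+ k ℕ.+ l ℕ.≟ n)
         (cartesianProduct r (cartesianProduct r (cartesianProduct r r))) f ⟩
  ∑ᶻ (cartesianProduct r (cartesianProduct r (cartesianProduct r r))) f′
    ≡⟨ ∑ᶻ-cartesianProduct r (cartesianProduct r (cartesianProduct r r)) f′ ⟩
  ∑ᶻ r (λ i → ∑ᶻ (cartesianProduct r (cartesianProduct r r)) λ jkl → f′ (i , jkl))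
    ≡⟨ ∑ᶻ-cong r (λ i → trans
         (∑ᶻ-cartesianProduct r (cartesianProduct r r) (λ jkl → f′ (i , jkl)))
         (∑ᶻ-cong r λ j → ∑ᶻ-cartesianProduct r r (λ kl → f′ (i , j , kl)))) ⟩
  ∑∑ (suc n) (λ i j → ∑∑ (suc n) λ k l → f′ (i , j , k , l))
    -- Rebracketing as (i + j) + (k + l) exhibits the sum as a convolution of two squares, each
    -- itself a `Push` along addition.
    ≡⟨ ∑∑-cong (suc n) (λ i j → ∑∑-cong (suc n) λ k l →
         cong (λ s → δ s n ℤ.* f (i , j , k , l)) (ℕₚ.+-assoc (i ℕ.+ j) k l)) ⟩
  ∑∑ (suc n) (λ i j → ∑∑ (suc n) λ k l → δ (i ℕ.+ j ℕ.+ (k ℕ.+ l)) n ℤ.* f (i , j , k , l))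
    ≡⟨ sym (conv-Push (suc n) ℕ._+_ (λ i j → u i ℤ.* u j) (λ i j → u i ℤ.* u j) (ℕₚ.n<1+n n)) ⟩
  conv (suc n) (conv (suc n) u u) (conv (suc n) u u) n  ∎
  where
  open ≡-Reasoning
  r : List ℕ
  r = upTo (suc n)
  f f′ : ℕ × ℕ × ℕ × ℕ → ℤ
  f (i , j , k , l) = (u i ℤ.* u j) ℤ.* (u k ℤ.* u l)
  f′ (i , j , k , l) = δ (i ℕ.+ j ℕ.+ k ℕ.+ l) n ℤ.* f (i , j , k , l)

-- Clearing the denominators 24 and 8

scale : ∀ a c z → fromℤ a * c ≡ (+ 1 / 1) → fromℤ z ≡ fromℤ (a ℤ.* z) * c
scale a c z ac≡1 = sym (trans (cong (_* c) (fromℤ-* a z)) (trans (rearrange (fromℤ a) (fromℤ z) c)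
  (trans (cong (_* fromℤ z) ac≡1) (ℚₚ.*-identityˡ (fromℤ z)))))
  where
  open ℚ-Solver.+-*-Solver
  rearrange : ∀ a z c → a * z * c ≡ a * c * z
  rearrange = solve 3 (λ a z c → a :* z :* c := a :* c :* z) refl

ĥ-scaled : ∀ i → (σ̂ at0 (+ 1 / 24)) i ≡ fromℤ (24ĥ i) * (+ 1 / 24)
ĥ-scaled zero    = refl
ĥ-scaled (suc i) = scale (+ 24) (+ 1 / 24) (σ̂ (suc i)) refl

t̃-scaled : ∀ i → (σ̃ 5 at0 (+ 1 / 8)) i ≡ fromℤ (8t̃ i) * (+ 1 / 8)
t̃-scaled zero    = refl
t̃-scaled (suc i) = scale (+ 8) (+ 1 / 8) (σ̃ 5 (suc i)) refl

theorem3p8 : (n : ℕ) → .{{_ : NonZero n}} → 2 ∤ n →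
    let h : ℕ → ℚ
        h = σ̂ at0 (+ 1 / 24)
        t : ℕ → ℚ
        t = σ̃ 5 at0 (+ 1 / 8)
    in
    fromℤ (σ 7 n) ≡
      (+ 12 / 1) *
        ((+ 864 / 1) * ∑ (quadruples n) (λ (i , j , k , l) → h i * h j * h k * h l)
          - ∑ (pairs n) (λ (i , j) → h i * t j))
theorem3p8 n 2∤n = sym (begin
  (+ 12 / 1) * ((+ 864 / 1) * ∑ (quadruples n) (λ (i , j , k , l) → h i * h j * h k * h l)
                - ∑ (pairs n) (λ (i , j) → h i * t j))
    ≡⟨ cong₂ (λ q p → (+ 12 / 1) * ((+ 864 / 1) * q - p)) quadruples≡ pairs≡ ⟩
  (+ 12 / 1) * ((+ 864 / 1) * ((fromℤ (+ 32) * fromℤ (σ 7 n) + fromℤ (+ 2) * fromℤ ĥt̃) * (c * c * (c * c)))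
                - fromℤ ĥt̃ * (c * d))
    ≡⟨ combine (fromℤ (σ 7 n)) (fromℤ ĥt̃) ⟩
  fromℤ (σ 7 n)  ∎)
  where
  open ≡-Reasoning
  open ℚ-Solver.+-*-Solver
  h t : ℕ → ℚ
  h = σ̂ at0 (+ 1 / 24)
  t = σ̃ 5 at0 (+ 1 / 8)
  c d : ℚ
  c = + 1 / 24
  d = + 1 / 8
  ĥt̃ : ℤ
  ĥt̃ = conv (suc n) 24ĥ 8t̃ n
  -- 12 · 864 · 32 / 24⁴ = 1 makes the coefficient of `s` equal to 1, and 12 · 864 · 2 / 24⁴ = 12 /
  -- (24 · 8) cancels `y`.
  combine : ∀ s y →
    (+ 12 / 1) * ((+ 864 / 1) * ((fromℤ (+ 32) * s + fromℤ (+ 2) * y) * (c * c * (c * c))) - y * (c * d)) ≡ s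
  combine = solve 2 (λ s y →
    con (+ 12 / 1) :* (con (+ 864 / 1) :* ((con (fromℤ (+ 32)) :* s :+ con (fromℤ (+ 2)) :* y) :* (con c :* con c :* (con c :* con c)))
                       :- y :* (con c :* con d)) := s) refl
  product₂ : ∀ a b → a * c * (b * d) ≡ a * b * (c * d)
  product₂ = solve 2 (λ a b → a :* con c :* (b :* con d) := a :* b :* (con c :* con d)) refl
  product₄ : ∀ a₁ a₂ a₃ a₄ → a₁ * c * (a₂ * c) * (a₃ * c) * (a₄ * c) ≡ a₁ * a₂ * (a₃ * a₄) * (c * c * (c * c))
  product₄ = solve 4 (λ a₁ a₂ a₃ a₄ → a₁ :* con c :* (a₂ :* con c) :* (a₃ :* con c) :* (a₄ :* con c) :=
    a₁ :* a₂ :* (a₃ :* a₄) :* (con c :* con c :* (con c :* con c))) refl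
  pairs≡ : ∑ (pairs n) (λ (i , j) → h i * t j) ≡ fromℤ ĥt̃ * (c * d)
  pairs≡ = trans
    (∑-fromℤ (pairs n) (λ (i , j) → 24ĥ i ℤ.* 8t̃ j) (c * d) λ (i , j) →
      trans (cong₂ _*_ (ĥ-scaled i) (t̃-scaled j))
            (trans (product₂ (fromℤ (24ĥ i)) (fromℤ (8t̃ j))) (cong (_* (c * d)) (sym (fromℤ-* (24ĥ i) (8t̃ j))))))
    (cong (λ z → fromℤ z * (c * d)) (∑-pairs n 24ĥ 8t̃))
  quadruples≡ : ∑ (quadruples n) (λ (i , j , k , l) → h i * h j * h k * h l) ≡
                (fromℤ (+ 32) * fromℤ (σ 7 n) + fromℤ (+ 2) * fromℤ ĥt̃) * (c * c * (c * c))
  quadruples≡ = begin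
    ∑ (quadruples n) (λ (i , j , k , l) → h i * h j * h k * h l)
      ≡⟨ ∑-fromℤ (quadruples n) (λ (i , j , k , l) → (24ĥ i ℤ.* 24ĥ j) ℤ.* (24ĥ k ℤ.* 24ĥ l)) (c * c * (c * c))
           (λ (i , j , k , l) →
           trans (cong₂ _*_ (cong₂ _*_ (cong₂ _*_ (ĥ-scaled i) (ĥ-scaled j)) (ĥ-scaled k)) (ĥ-scaled l))
           (trans (product₄ (fromℤ (24ĥ i)) (fromℤ (24ĥ j)) (fromℤ (24ĥ k)) (fromℤ (24ĥ l)))
                  (cong (_* (c * c * (c * c))) (sym (trans (fromℤ-* (24ĥ i ℤ.* 24ĥ j) (24ĥ k ℤ.* 24ĥ l))
                    (cong₂ _*_ (fromℤ-* (24ĥ i) (24ĥ j)) (fromℤ-* (24ĥ k) (24ĥ l)))))))) ⟩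
    fromℤ (∑ᶻ (quadruples n) (λ (i , j , k , l) → (24ĥ i ℤ.* 24ĥ j) ℤ.* (24ĥ k ℤ.* 24ĥ l))) * (c * c * (c * c))
      ≡⟨ cong (λ z → fromℤ z * (c * c * (c * c)))
           (trans (∑-quadruples n 24ĥ) (fourfold-convolution (suc n) (ℕₚ.n<1+n n) 2∤n)) ⟩
    fromℤ (+ 32 ℤ.* σ 7 n ℤ.+ + 2 ℤ.* ĥt̃) * (c * c * (c * c))
      ≡⟨ cong (_* (c * c * (c * c))) (trans (fromℤ-+ (+ 32 ℤ.* σ 7 n) (+ 2 ℤ.* ĥt̃))
           (cong₂ _+_ (fromℤ-* (+ 32) (σ 7 n)) (fromℤ-* (+ 2) ĥt̃))) ⟩
    (fromℤ (+ 32) * fromℤ (σ 7 n) + fromℤ (+ 2) * fromℤ ĥt̃) * (c * c * (c * c))  ∎
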